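{- Let $q$ be an odd prime power, let $t\geq 3$ be an integer and $n=2t$. For each $h\in \mathbb{F}_{q^n}\setminus \mathbb{F}_{q^t}$ such that $h^{q^t+1}=-1$, the $\mathbb{F}_q$-linearized polynomial \[\psi_{h,t}(x)= x^{q}+x^{q^{t-1}}-h^{1-q^{t+1}}x^{q^{t+1}}+h^{1-q^{2t-1}}x^{q^{2t-1}} \in \mathbb{F}_{q^{n}}[x]\] is scattered over $\mathbb{F}_{q^n}$.
   Context: A $q$-polynomial over $\mathbb{F}_{q^n}$ is a polynomial $f(x)=\sum_{i=0}^{n-1}c_ix^{q^i}$ with $c_i\in\mathbb{F}_{q^n}$, viewed as an $\mathbb{F}_q$-linear map of $\mathbb{F}_{q^n}$. Such an $f$ is called scattered (over $\mathbb{F}_{q^n}$) if for all $x\in\mathbb{F}_{q^n}^*$ and $\gamma\in\mathbb{F}_{q^n}$, the equality $f(\gamma x)=\gamma f(x)$ implies $\gamma\in\mathbb{F}_q$; equivalently, for $z,y\in\mathbb{F}_{q^n}^*$, $f(z)/z=f(y)/y$ implies that $z,y$ are $\mathbb{F}_q$-linearly dependent. Negative exponents such as $h^{1-q^{t+1}}$ make sense since $h\neq 0$. -}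

module Defs where

open import Level using (Level; suc; _⊔_)
open import Data.Nat as ℕ using (ℕ; _∸_)
open import Data.Nat.Primality using (Prime)
open import Data.Fin using (Fin)
open import Data.Product using (Σ; _×_; ∃)
open import Relation.Nullary using (¬_)
open import Relation.Binary.PropositionalEquality as ≡ using (_≡_)
open import Algebra.Bundles using (CommutativeRing)
import Algebra.Bundles
import Algebra.Definitions.RawSemiring as RS
open import Function.Bundles using (Bijection)

-- A field: a commutative ring with 0 ≉ 1 in which every nonzero element
-- has a multiplicative inverse, given by a (total) function _⁻¹
-- (its value at 0 is irrelevant).
record Field (c ℓ : Level) : Set (suc (c ⊔ ℓ)) where
  field
    commutativeRing : CommutativeRing c ℓ
  open CommutativeRing commutativeRing public
  field
    _⁻¹     : Carrier → Carrier
    0≉1     : ¬ (0# ≈ 1#)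
    inverse : ∀ x → ¬ (x ≈ 0#) → x * (x ⁻¹) ≈ 1#

  open RS (Algebra.Bundles.Semiring.rawSemiring semiring) public using (_^_)

HasCardinality : ∀ {c ℓ} → Field c ℓ → ℕ → Set (c ⊔ ℓ)
HasCardinality F N = Bijection (Field.setoid F) (≡.setoid (Fin N))

IsPrimePower : ℕ → Set
IsPrimePower q = Σ ℕ λ p → Σ ℕ λ k → Prime p × (1 ℕ.≤ k) × (q ≡ p ℕ.^ k)

Odd : ℕ → Set
Odd q = q ℕ.% 2 ≡ 1

module _ {c ℓ} (F : Field c ℓ) where
  open Field F

  -- In a field of order q^n, the subfield F_{q^m} (m ∣ n) is
  -- { x | x^(q^m) = x }.
  InSubfield : ℕ → ℕ → Carrier → Set ℓ
  InSubfield q m x = x ^ (q ℕ.^ m) ≈ x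

  Scattered : ℕ → (Carrier → Carrier) → Set (c ⊔ ℓ)
  Scattered q f = ∀ x γ → ¬ (x ≈ 0#) → f (γ * x) ≈ γ * f x → InSubfield q 1 γ

  ψ : ℕ → ℕ → Carrier → Carrier → Carrier
  ψ q t h x =
      x ^ q
    + x ^ (q ℕ.^ (t ∸ 1))
    - (h * (h ^ (q ℕ.^ (t ℕ.+ 1))) ⁻¹) * x ^ (q ℕ.^ (t ℕ.+ 1))
    + (h * (h ^ (q ℕ.^ (2 ℕ.* t ∸ 1))) ⁻¹) * x ^ (q ℕ.^ (2 ℕ.* t ∸ 1))

{-# OPTIONS --safe #-}
module Submission where

-- Let σ(x) = x^q, τ = σ^t, ρ = σ⁻¹ and hᵢ = σⁱ(h), so that τ is an involution
-- and hᵢ τ(hᵢ) = -1. Every x splits as x₁ + x₂ with h₀h₋₁ τ(x₁) = -x₁ and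
-- h₀ τ(x₂) = -h₁ x₂, and gᵢ = 1 - hᵢhᵢ₊₂ turns ψ into
--   h₋₁h₋₂ ψ(x) = h₋₁h₋₂g₀ σ(x₂) - g₋₂ ρ(x₁).
-- Suppose y = γx and ψ(y) = γψ(x), and expand ψ(x)y - ψ(y)x = 0. The diagonal
-- terms and the two kinds of mixed terms lie in eigenlines of the
-- same τ-semilinear map, so comparing with the image under τ ties the mixed
-- terms together. For u = σ(x₂)y₁ - σ(y₂)x₁ this says that
-- g₀g₋₁u / (h₁h₀h₋₁) is fixed by σ, whereas τ changes its sign; so u = 0, and
-- the diagonal part vanishes as well. Writing y₂ = βx₂, the first gives
-- y₁ = σ(β)x₁ and the second (β - σ(β)) times a factor that cannot vanish,
-- since otherwise some v would satisfy v σ(v) = -1 and τ(v) = -v.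
-- So β, and hence γ, lies in F_q.

open import Defs
open import Level using (Level)
open import Algebra.Bundles using (CommutativeMonoid; CommutativeRing)
open import Algebra.Morphism.Structures using (module RingMorphisms)
import Algebra.Properties.CommutativeMonoid.Sum
open import Data.Fin using (Fin; zero; suc; fromℕ; inject₁; punchIn)
open import Data.Fin.Permutation using (Permutation′; permutation)
open import Data.Fin.Properties using (toℕ-fromℕ; toℕ-inject₁; toℕ<n; punchInᵢ≢i)
open import Data.Integer as ℤ using (ℤ; +_; -[1+_]; _⊖_; _◃_; sign; ∣_∣)
import Data.Integer.Properties as ℤ
open import Data.Maybe as Maybe using (Maybe)
open import Data.Nat as ℕ using (ℕ; zero; suc; _≤_; _<_; _∸_; s≤s; z≤n)
open import Data.Nat.Combinatorics using (_C_; nCn≡1; nCk≡n!/k![n-k]!; k![n∸k]!∣n!)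
open import Data.Nat.Divisibility using (_∣_; divides; ∣⇒≤; m∣m*n)
open import Data.Nat.DivMod using (m/n*n≡m; m≡m%n+[m/n]*n; %-distribˡ-*)
open import Data.Nat.Primality using (Prime; euclidsLemma; prime⇒nonTrivial)
import Data.Nat.Properties as ℕ
open import Data.Product using (_,_; proj₁; proj₂; _×_; ∃₂)
open import Data.Sign as Sign using (Sign)
open import Data.Sum using (_⊎_; inj₁; inj₂)
open import Function using (_∘_)
open import Function.Bundles using (Bijection)
open import Relation.Binary.Bundles using (Setoid)
open import Relation.Binary.PropositionalEquality as ≡ using (_≡_; _≢_)
open import Relation.Nullary using (¬_; yes; no; Dec; contradiction)
open import Relation.Nullary.Decidable using (dec⇒maybe)

-- Ring solver with integer coefficients

module IntegerSolver {c ℓ : Level} (R : CommutativeRing c ℓ) where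
  open CommutativeRing R hiding (zero)
  open import Algebra.Properties.Ring ring
  open import Algebra.Properties.AbelianGroup +-abelianGroup using (⁻¹-∙-comm)
  open import Algebra.Properties.CommutativeSemigroup
    (CommutativeRing.+-commutativeSemigroup R) using (interchange)
  open import Algebra.Properties.Semiring.Mult.TCOptimised semiring
    using (1+×; ×-homo-+; ×1-homo-*) renaming (_×_ to _·_)
  open import Algebra.Solver.Ring.AlmostCommutativeRing
  open import Relation.Binary.Reasoning.Setoid setoid

  fromℤ : ℤ → Carrier
  fromℤ (+ n)    = n · 1#
  fromℤ -[1+ n ] = - (suc n · 1#)

  signed : Sign → Carrier → Carrier
  signed Sign.+ x = x
  signed Sign.- x = - x

  fromℤ-◃ : ∀ s n → fromℤ (s ◃ n) ≈ signed s (n · 1#)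
  fromℤ-◃ Sign.+ zero    = refl
  fromℤ-◃ Sign.- zero    = sym -0#≈0#
  fromℤ-◃ Sign.+ (suc n) = refl
  fromℤ-◃ Sign.- (suc n) = refl

  fromℤ-sign-abs : ∀ i → fromℤ i ≈ signed (sign i) (∣ i ∣ · 1#)
  fromℤ-sign-abs (+ n)    = refl
  fromℤ-sign-abs -[1+ n ] = refl

  signed-* : ∀ s s′ x y → signed (s Sign.* s′) (x * y) ≈ signed s x * signed s′ y
  signed-* Sign.+ Sign.+ x y = refl
  signed-* Sign.+ Sign.- x y = -‿distribʳ-* x y
  signed-* Sign.- Sign.+ x y = -‿distribˡ-* x y
  signed-* Sign.- Sign.- x y = begin
    x * y         ≈⟨ -‿involutive _ ⟨
    - (- (x * y)) ≈⟨ -‿cong (-‿distribʳ-* x y) ⟩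
    - (x * (- y)) ≈⟨ -‿distribˡ-* x (- y) ⟩
    (- x) * (- y) ∎

  signed-cong : ∀ s {x y} → x ≈ y → signed s x ≈ signed s y
  signed-cong Sign.+ x≈y = x≈y
  signed-cong Sign.- x≈y = -‿cong x≈y

  fromℤ-* : ∀ i j → fromℤ (i ℤ.* j) ≈ fromℤ i * fromℤ j
  fromℤ-* i j = begin
    fromℤ (sign i Sign.* sign j ◃ ∣ i ∣ ℕ.* ∣ j ∣)
      ≈⟨ fromℤ-◃ (sign i Sign.* sign j) (∣ i ∣ ℕ.* ∣ j ∣) ⟩
    signed (sign i Sign.* sign j) ((∣ i ∣ ℕ.* ∣ j ∣) · 1#)
      ≈⟨ signed-cong (sign i Sign.* sign j) (×1-homo-* ∣ i ∣ ∣ j ∣) ⟩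
    signed (sign i Sign.* sign j) (∣ i ∣ · 1# * ∣ j ∣ · 1#)
      ≈⟨ signed-* (sign i) (sign j) _ _ ⟩
    signed (sign i) (∣ i ∣ · 1#) * signed (sign j) (∣ j ∣ · 1#)
      ≈⟨ *-cong (fromℤ-sign-abs i) (fromℤ-sign-abs j) ⟨
    fromℤ i * fromℤ j ∎

  -- Induction on both numbers: in the successor case `1# - 1#` is inserted and regrouped, so that
  -- each multiple absorbs one unit.
  fromℤ-⊖ : ∀ m n → fromℤ (m ⊖ n) ≈ m · 1# - n · 1#
  fromℤ-⊖ m zero = sym (trans (+-congˡ -0#≈0#) (+-identityʳ _))
  fromℤ-⊖ zero (suc n) = sym (+-identityˡ _)
  fromℤ-⊖ (suc m) (suc n) = begin
    fromℤ (suc m ⊖ suc n)             ≡⟨ ≡.cong fromℤ (ℤ.[1+m]⊖[1+n]≡m⊖n m n) ⟩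
    fromℤ (m ⊖ n)                     ≈⟨ fromℤ-⊖ m n ⟩
    m · 1# - n · 1#                   ≈⟨ +-identityˡ _ ⟨
    0# + (m · 1# - n · 1#)            ≈⟨ +-congʳ (-‿inverseʳ 1#) ⟨
    1# - 1# + (m · 1# - n · 1#)       ≈⟨ interchange _ _ _ _ ⟩
    1# + m · 1# + (- 1# - n · 1#)     ≈⟨ +-congˡ (⁻¹-∙-comm 1# _) ⟩
    1# + m · 1# - (1# + n · 1#)       ≈⟨ +-cong (1+× m 1#) (-‿cong (1+× n 1#)) ⟨
    suc m · 1# - suc n · 1#           ∎

  fromℤ-+ : ∀ i j → fromℤ (i ℤ.+ j) ≈ fromℤ i + fromℤ j
  fromℤ-+ (+ m)    (+ n)    = ×-homo-+ 1# m n
  fromℤ-+ (+ m)    -[1+ n ] = fromℤ-⊖ m (suc n)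
  fromℤ-+ -[1+ m ] (+ n)    = trans (fromℤ-⊖ n (suc m)) (+-comm _ _)
  fromℤ-+ -[1+ m ] -[1+ n ] = begin
    - (suc (suc (m ℕ.+ n)) · 1#)         ≡⟨ ≡.cong (λ k → - (suc k · 1#)) (ℕ.+-suc m n) ⟨
    - ((suc m ℕ.+ suc n) · 1#)           ≈⟨ -‿cong (×-homo-+ 1# (suc m) (suc n)) ⟩
    - (suc m · 1# + suc n · 1#)          ≈⟨ ⁻¹-∙-comm _ _ ⟨
    - (suc m · 1#) - suc n · 1#          ∎

  fromℤ-neg : ∀ i → fromℤ (ℤ.- i) ≈ - fromℤ i
  fromℤ-neg (+ zero)  = sym -0#≈0#
  fromℤ-neg (+ suc n) = refl
  fromℤ-neg -[1+ n ]  = sym (-‿involutive _)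

  fromℤ-homomorphism :
    ℤ.+-*-rawRing -Raw-AlmostCommutative⟶ fromCommutativeRing R
  fromℤ-homomorphism = record
    { ⟦_⟧    = fromℤ
    ; +-homo = fromℤ-+
    ; *-homo = fromℤ-*
    ; -‿homo = fromℤ-neg
    ; 0-homo = refl
    ; 1-homo = refl
    }

  -- Coefficients are compared as integers, never in the ring. A failed comparison says nothing
  -- about the ring, which may have positive characteristic; the identities solved below already
  -- hold over the integers.
  _≟ᶜ_ : ∀ i j → Maybe (fromℤ i ≈ fromℤ j)
  i ≟ᶜ j = Maybe.map (λ i≡j → reflexive (≡.cong fromℤ i≡j)) (dec⇒maybe (i ℤ.≟ j))

  open import Algebra.Solver.Ring ℤ.+-*-rawRing (fromCommutativeRing R) fromℤ-homomorphism _≟ᶜ_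
    public using (Polynomial; solve; _:=_; _:+_; _:*_; _:-_; :-_; con)

-- Finite fields: x^N = x and the Frobenius endomorphism

-- By Euclid's lemma `p` would divide one of the factors of the factorial, all of which are positive
-- and smaller than `p`.
prime∤! : ∀ {p} → Prime p → ∀ {m} → m < p → ¬ (p ∣ m ℕ.!)
prime∤! {p} pp {zero}  m<p p∣1 = ℕ.<⇒≱ (ℕ.nonTrivial⇒n>1 p {{prime⇒nonTrivial pp}}) (∣⇒≤ p∣1)
prime∤! pp {suc m} m<p p∣m! with euclidsLemma (suc m) (m ℕ.!) pp p∣m!
... | inj₁ p∣1+m = ℕ.<⇒≱ m<p (∣⇒≤ p∣1+m)
... | inj₂ p∣m!′ = prime∤! pp (ℕ.<-trans ℕ.≤-refl m<p) p∣m!′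

-- `p` divides p! = C · k! · (p - k)!, and it divides neither factorial because both arguments lie
-- below `p`.
prime∣C : ∀ {p k} → Prime p → 0 < k → k < p → p ∣ p C k
prime∣C {suc p} {suc k} pp 0<k k<p
  with euclidsLemma (suc p C suc k) ((suc k) ℕ.! ℕ.* (suc p ∸ suc k) ℕ.!) pp
         (≡.subst (suc p ∣_) eq (m∣m*n {suc p} (p ℕ.!)))
  where
  instance _ = (suc k) ℕ.!* (p ∸ k) !≢0
  eq : (suc p) ℕ.! ≡ (suc p C suc k) ℕ.* ((suc k) ℕ.! ℕ.* (suc p ∸ suc k) ℕ.!)
  eq = ≡.sym (≡.trans
    (≡.cong (ℕ._* ((suc k) ℕ.! ℕ.* (suc p ∸ suc k) ℕ.!)) (nCk≡n!/k![n-k]! (ℕ.<⇒≤ k<p)))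
    (m/n*n≡m (k![n∸k]!∣n! (ℕ.<⇒≤ k<p))))
... | inj₁ p∣C = p∣C
... | inj₂ p∣!! with euclidsLemma ((suc k) ℕ.!) ((suc p ∸ suc k) ℕ.!) pp p∣!!
...   | inj₁ p∣k! = contradiction p∣k! (prime∤! pp k<p)
-- Since the lower index is a successor, the difference reduces to `p ∸ k` and so stays strictly
-- below `suc p`.
...   | inj₂ p∣[p-k]! = contradiction p∣[p-k]! (prime∤! pp (s≤s (ℕ.m∸n≤m p k)))

-- Enumeration of a finite setoid and reindexing of sums

module FiniteSetoid {a ℓ : Level} (S : Setoid a ℓ) {N : ℕ}
                    (bij : Bijection S (≡.setoid (Fin N))) where
  open Setoid S
  open Bijection bij using (to; injective; surjective) renaming (cong to to-cong)

  enumerate : Fin N → Carrier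
  enumerate i = proj₁ (surjective i)

  to-enumerate : ∀ i → to (enumerate i) ≡ i
  to-enumerate i = proj₂ (surjective i) refl

  enumerate-to : ∀ x → enumerate (to x) ≈ x
  enumerate-to x = injective (to-enumerate (to x))

  _≟_ : ∀ x y → Dec (x ≈ y)
  x ≟ y with to x Data.Fin.≟ to y
  ... | yes eq = yes (injective eq)
  ... | no neq = no (neq ∘ to-cong)

  module _ {b ℓ′ : Level} (M : CommutativeMonoid b ℓ′) where
    private module M = CommutativeMonoid M
    open import Algebra.Properties.CommutativeMonoid.Sum M

    -- Conjugating `f` and its inverse `g` with the enumeration gives a permutation of `Fin N`,
    -- under which a finite sum is invariant. It is applied to translations in the additive monoid
    -- and to scalings in the multiplicative one.
    sum-bijection : (v : Carrier → M.Carrier) → (∀ {x y} → x ≈ y → v x M.≈ v y) →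
                    (f g : Carrier → Carrier) →
                    (∀ {x y} → x ≈ y → f x ≈ f y) → (∀ {x y} → x ≈ y → g x ≈ g y) →
                    (∀ x → f (g x) ≈ x) → (∀ x → g (f x) ≈ x) →
                    sum (v ∘ enumerate) M.≈ sum (v ∘ f ∘ enumerate)
    sum-bijection v v-cong f g f-cong g-cong fg gf = M.trans
      (sum-permute (v ∘ enumerate) π)
      (sum-cong-≋ (λ i → v-cong (enumerate-to (f (enumerate i)))))
      where
      π : Permutation′ N
      π = permutation (to ∘ f ∘ enumerate) (to ∘ g ∘ enumerate)
        (λ i → ≡.trans (to-cong (trans (f-cong (enumerate-to _)) (fg _))) (to-enumerate i))
        (λ i → ≡.trans (to-cong (trans (g-cong (enumerate-to _)) (gf _))) (to-enumerate i))

module _ {b ℓ : Level} (M : CommutativeMonoid b ℓ) where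
  open CommutativeMonoid M
  open import Algebra.Properties.CommutativeMonoid.Sum M

  sum-single : ∀ {n} (f : Fin n → Carrier) (i : Fin n) → (∀ j → j ≢ i → f j ≈ ε) → sum f ≈ f i
  sum-single {suc n} f i f≈ε = trans (sum-remove {i = i} f)
    (trans (∙-congˡ (trans (sum-cong-≋ (λ j → f≈ε (punchIn i j) (punchInᵢ≢i i j)))
                           (sum-replicate-zero n)))
           (identityʳ (f i)))

-- Cancellation and nonzero products in a field

module FieldProperties {c ℓ : Level} (F : Field c ℓ) where
  open Field F hiding (zero)
  open import Relation.Binary.Reasoning.Setoid setoid

  open import Algebra.Properties.CommutativeMonoid.Sum *-commutativeMonoid
    using () renaming (sum to product)

  _≉0 : Carrier → Set ℓ
  x ≉0 = ¬ (x ≈ 0#)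

  *-cancelˡ : ∀ {x y z} → x ≉0 → x * y ≈ x * z → y ≈ z
  *-cancelˡ {x} {y} {z} x≉0 xy≈xz = begin
    y                ≈⟨ *-identityˡ y ⟨
    1# * y           ≈⟨ *-congʳ x⁻¹x ⟨
    x ⁻¹ * x * y     ≈⟨ *-assoc _ _ _ ⟩
    x ⁻¹ * (x * y)   ≈⟨ *-congˡ xy≈xz ⟩
    x ⁻¹ * (x * z)   ≈⟨ *-assoc _ _ _ ⟨
    x ⁻¹ * x * z     ≈⟨ *-congʳ x⁻¹x ⟩
    1# * z           ≈⟨ *-identityˡ z ⟩
    z                ∎
    where
    x⁻¹x : x ⁻¹ * x ≈ 1#
    x⁻¹x = trans (*-comm _ _) (inverse x x≉0)

  *-zero-right : ∀ {x y} → x ≉0 → x * y ≈ 0# → y ≈ 0#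
  *-zero-right x≉0 xy≈0 = *-cancelˡ x≉0 (trans xy≈0 (sym (zeroʳ _)))

  *-≉0 : ∀ {x y} → x ≉0 → y ≉0 → (x * y) ≉0
  *-≉0 x≉0 y≉0 xy≈0 = y≉0 (*-zero-right x≉0 xy≈0)

  1≉0 : 1# ≉0
  1≉0 1≈0 = 0≉1 (sym 1≈0)

  product-≉0 : ∀ {n} (f : Fin n → Carrier) → (∀ i → f i ≉0) →
               product f ≉0
  product-≉0 {zero}  f f≉0 = 1≉0
  product-≉0 {suc n} f f≉0 = *-≉0 (f≉0 zero) (product-≉0 (f ∘ suc) (f≉0 ∘ suc))

module FiniteField {c ℓ : Level} (F : Field c ℓ) {N : ℕ} (card : HasCardinality F N) where
  open Field F hiding (zero)
  open FieldProperties F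
  open FiniteSetoid setoid card public
  open import Relation.Binary.Reasoning.Setoid setoid
  open import Algebra.Properties.Semiring.Mult semiring
    using (×-congˡ; ×-congʳ; ×1-homo-*; ×-assoc-*) renaming (_×_ to _×ᵣ_)
  open import Algebra.Properties.CommutativeSemiring.Exp commutativeSemiring
    using (^-congˡ; ^-assocʳ)
  open import Algebra.Properties.AbelianGroup +-abelianGroup using (∙-cancelˡ)
  module Sum = Algebra.Properties.CommutativeMonoid.Sum +-commutativeMonoid
  module Prod = Algebra.Properties.CommutativeMonoid.Sum *-commutativeMonoid

  -- Translation by `1#` permutes the field, so the sum `S` of all elements equals itself plus `N`
  -- copies of `1#`.
  cardinality×1≈0 : N ×ᵣ 1# ≈ 0#
  cardinality×1≈0 = ∙-cancelˡ S _ _ (begin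
    S + N ×ᵣ 1#                        ≈⟨ +-congˡ (Sum.sum-replicate N) ⟨
    S + Sum.sum {N} (λ _ → 1#)         ≈⟨ Sum.∑-distrib-+ enumerate (λ _ → 1#) ⟨
    Sum.sum (λ i → enumerate i + 1#)
      ≈⟨ sum-bijection +-commutativeMonoid (λ x → x) (λ x≈y → x≈y) (_+ 1#) (_- 1#)
           +-congʳ +-congʳ
           (λ x → trans (+-assoc _ _ _) (trans (+-congˡ (-‿inverseˡ 1#)) (+-identityʳ x)))
           (λ x → trans (+-assoc _ _ _) (trans (+-congˡ (-‿inverseʳ 1#)) (+-identityʳ x))) ⟨
    S                                  ≈⟨ +-identityʳ S ⟨
    S + 0#                             ∎)
    where S = Sum.sum enumerate

  ifZero : Carrier → Carrier → Carrier → Carrier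
  ifZero x y z with x ≟ 0#
  ... | yes _ = y
  ... | no  _ = z

  ifZero-yes : ∀ {x} y z → x ≈ 0# → ifZero x y z ≈ y
  ifZero-yes {x} y z x≈0 with x ≟ 0#
  ... | yes _  = refl
  ... | no x≉0 = contradiction x≈0 x≉0

  ifZero-no : ∀ {x} y z → x ≉0 → ifZero x y z ≈ z
  ifZero-no {x} y z x≉0 with x ≟ 0#
  ... | yes x≈0 = contradiction x≈0 x≉0
  ... | no _    = refl

  -- Replacing 0 by 1 lets the product of all nonzero elements range over the
  -- whole field.
  nonzeroPart : Carrier → Carrier
  nonzeroPart x = ifZero x 1# x

  nonzeroPart-≉0 : ∀ x → nonzeroPart x ≉0
  nonzeroPart-≉0 x with x ≟ 0#
  ... | yes _  = 1≉0
  ... | no x≉0 = x≉0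

  nonzeroPart-cong : ∀ {x y} → x ≈ y → nonzeroPart x ≈ nonzeroPart y
  nonzeroPart-cong {x} {y} x≈y with x ≟ 0#
  ... | yes x≈0 = sym (ifZero-yes 1# y (trans (sym x≈y) x≈0))
  ... | no  x≉0 = trans x≈y (sym (ifZero-no 1# y (λ y≈0 → x≉0 (trans x≈y y≈0))))

  nonzeroPart-* : ∀ {a} → a ≉0 → ∀ x →
                  nonzeroPart (a * x) ≈ ifZero x 1# a * nonzeroPart x
  nonzeroPart-* {a} a≉0 x with x ≟ 0#
  ... | yes x≈0 = trans (ifZero-yes 1# (a * x) (trans (*-congˡ x≈0) (zeroʳ a))) (sym (*-identityˡ 1#))
  ... | no  x≉0 = ifZero-no 1# (a * x) (*-≉0 a≉0 x≉0)

  -- Multiplication by `a` permutes the nonzero elements and hence fixes their product. Each of the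
  -- `N` factors of `a ^ N` is charged to a field element: the zero element contributes `a`, the
  -- nonzero ones together contribute `U`, which is 1.
  x^N≈x-nonzero : ∀ {a} → a ≉0 → a ^ N ≈ a
  x^N≈x-nonzero {a} a≉0 = begin
    a ^ N                                      ≈⟨ Prod.sum-replicate N ⟨
    Prod.sum {N} (λ _ → a)                     ≈⟨ Prod.sum-cong-≋ split ⟩
    Prod.sum (λ i → ifZero (enumerate i) a 1# * ifZero (enumerate i) 1# a)
      ≈⟨ Prod.∑-distrib-+ (λ i → ifZero (enumerate i) a 1#) (λ i → ifZero (enumerate i) 1# a) ⟩
    Prod.sum (λ i → ifZero (enumerate i) a 1#) * U ≈⟨ *-cong zeros U≈1 ⟩
    a * 1#                                     ≈⟨ *-identityʳ a ⟩
    a                                          ∎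
    where
    U = Prod.sum (λ i → ifZero (enumerate i) 1# a)
    Π = Prod.sum (nonzeroPart ∘ enumerate)

    split : ∀ i → a ≈ ifZero (enumerate i) a 1# * ifZero (enumerate i) 1# a
    split i with enumerate i ≟ 0#
    ... | yes _ = sym (*-identityʳ a)
    ... | no  _ = sym (*-identityˡ a)

    zeros : Prod.sum (λ i → ifZero (enumerate i) a 1#) ≈ a
    zeros = trans
      (sum-single *-commutativeMonoid (λ i → ifZero (enumerate i) a 1#) (Bijection.to card 0#)
        (λ j j≢0 → ifZero-no a 1# (λ eq → j≢0 (≡.trans (≡.sym (to-enumerate j)) (Bijection.cong card eq)))))
      (ifZero-yes a 1# (enumerate-to 0#))

    inverse-cancel : ∀ {b c} → b * c ≈ 1# → ∀ x → b * (c * x) ≈ x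
    inverse-cancel bc≈1 x = trans (sym (*-assoc _ _ _)) (trans (*-congʳ bc≈1) (*-identityˡ x))

    U≈1 : U ≈ 1#
    U≈1 = *-cancelˡ (product-≉0 (nonzeroPart ∘ enumerate) (nonzeroPart-≉0 ∘ enumerate)) (begin
      Π * U                       ≈⟨ *-comm Π U ⟩
      U * Π                       ≈⟨ Prod.∑-distrib-+ (λ i → ifZero (enumerate i) 1# a) (nonzeroPart ∘ enumerate) ⟨
      Prod.sum (λ i → ifZero (enumerate i) 1# a * nonzeroPart (enumerate i))
                                  ≈⟨ Prod.sum-cong-≋ (nonzeroPart-* a≉0 ∘ enumerate) ⟨
      Prod.sum (λ i → nonzeroPart (a * enumerate i))
        ≈⟨ sum-bijection *-commutativeMonoid nonzeroPart nonzeroPart-cong (a *_) (a ⁻¹ *_)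
             *-congˡ *-congˡ (inverse-cancel (inverse a a≉0))
             (inverse-cancel (trans (*-comm _ _) (inverse a a≉0))) ⟨
      Π                           ≈⟨ *-identityʳ Π ⟨
      Π * 1#                      ∎)

  x^N≈x : ∀ x → x ^ N ≈ x
  x^N≈x x with x ≟ 0#
  ... | no  x≉0 = x^N≈x-nonzero x≉0
  -- The index of `0#` witnesses that `N` is positive; otherwise the power would be 1.
  ... | yes x≈0 = trans (^-congˡ N x≈0) (trans (0^N (Bijection.to card 0#)) (sym x≈0))
    where
    0^N : ∀ {n} → Fin n → 0# ^ n ≈ 0#
    0^N {suc n} _ = zeroˡ _

  module _ {p m : ℕ} (prime-p : Prime p) (N≡p^m : N ≡ p ℕ.^ m) where

    -- `N` times 1 vanishes and is a power of `p` times 1, while a field has no zero divisors.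
    characteristic : p ×ᵣ 1# ≈ 0#
    characteristic with (p ×ᵣ 1#) ≟ 0#
    ... | yes p≈0 = p≈0
    ... | no  p≉0 = contradiction cardinality×1≈0
      (≡.subst (λ n → (n ×ᵣ 1#) ≉0) (≡.sym N≡p^m) (powers m))
      where
      powers : ∀ n → ((p ℕ.^ n) ×ᵣ 1#) ≉0
      powers zero    eq = 1≉0 (trans (sym (+-identityʳ 1#)) eq)
      powers (suc n) eq = *-≉0 p≉0 (powers n) (trans (sym (×1-homo-* p (p ℕ.^ n))) eq)

    ∣⇒×≈0 : ∀ {n} → p ∣ n → ∀ x → n ×ᵣ x ≈ 0#
    ∣⇒×≈0 {n} (divides r n≡rp) x = begin
      n ×ᵣ x                        ≈⟨ ×-congˡ n≡rp ⟩
      (r ℕ.* p) ×ᵣ x                ≈⟨ ×-congʳ (r ℕ.* p) (*-identityˡ x) ⟨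
      (r ℕ.* p) ×ᵣ (1# * x)         ≈⟨ ×-assoc-* (r ℕ.* p) 1# x ⟨
      (r ℕ.* p) ×ᵣ 1# * x           ≈⟨ *-congʳ (×1-homo-* r p) ⟩
      r ×ᵣ 1# * (p ×ᵣ 1#) * x       ≈⟨ *-congʳ (*-congˡ characteristic) ⟩
      r ×ᵣ 1# * 0# * x              ≈⟨ *-congʳ (zeroʳ _) ⟩
      0# * x                        ≈⟨ zeroˡ x ⟩
      0#                            ∎

    -- All binomial coefficients except the two outer ones are divisible by `p`, so the middle terms
    -- vanish.
    frobenius : ∀ x y → (x + y) ^ p ≈ x ^ p + y ^ p
    frobenius x y = expand p prime-p ≡.refl
      where
      open import Algebra.Properties.CommutativeSemiring.Binomial commutativeSemiring
        using (binomialTerm) renaming (theorem to binomial-theorem)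
      -- The exponent is a variable merely equal to `p`, so that it can be matched as a successor
      -- and the two outer terms split off.
      expand : ∀ n → Prime n → n ≡ p → (x + y) ^ n ≈ x ^ n + y ^ n
      expand (suc n) pn ≡.refl = begin
        (x + y) ^ suc n                           ≈⟨ binomial-theorem (suc n) x y ⟩
        T zero + Sum.sum (T ∘ suc)                ≈⟨ +-congˡ (Sum.sum-init-last (T ∘ suc)) ⟩
        T zero + (Sum.sum (λ i → T (suc (inject₁ i))) + T (suc (fromℕ n)))
          ≈⟨ +-congˡ (+-congʳ (trans (Sum.sum-cong-≋ middle) (Sum.sum-replicate-zero n))) ⟩
        T zero + (0# + T (suc (fromℕ n)))         ≈⟨ +-cong first (trans (+-identityˡ _) last) ⟩
        y ^ suc n + x ^ suc n                     ≈⟨ +-comm _ _ ⟩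
        x ^ suc n + y ^ suc n                     ∎
        where
        T = binomialTerm x y (suc n)
        first : T zero ≈ y ^ suc n
        first = trans (+-identityʳ _) (*-identityˡ _)
        middle : ∀ i → T (suc (inject₁ i)) ≈ 0#
        middle i = ∣⇒×≈0 (prime∣C pn (s≤s z≤n)
          (s≤s (≡.subst (ℕ._< n) (≡.sym (toℕ-inject₁ i)) (toℕ<n i)))) _
        last : T (suc (fromℕ n)) ≈ x ^ suc n
        last rewrite toℕ-fromℕ n | nCn≡1 (suc n) | ℕ.n∸n≡0 n =
          trans (+-identityʳ _) (*-identityʳ _)

    frobenius-^ : ∀ n x y → (x + y) ^ (p ℕ.^ n) ≈ x ^ (p ℕ.^ n) + y ^ (p ℕ.^ n)
    frobenius-^ zero    x y = trans (*-identityʳ _) (sym (+-cong (*-identityʳ _) (*-identityʳ _)))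
    frobenius-^ (suc n) x y = begin
      (x + y) ^ (p ℕ.* p ℕ.^ n)                        ≈⟨ ^-assocʳ (x + y) p (p ℕ.^ n) ⟨
      ((x + y) ^ p) ^ (p ℕ.^ n)                        ≈⟨ ^-congˡ (p ℕ.^ n) (frobenius x y) ⟩
      (x ^ p + y ^ p) ^ (p ℕ.^ n)                      ≈⟨ frobenius-^ n (x ^ p) (y ^ p) ⟩
      (x ^ p) ^ (p ℕ.^ n) + (y ^ p) ^ (p ℕ.^ n)
        ≈⟨ +-cong (^-assocʳ x p (p ℕ.^ n)) (^-assocʳ y p (p ℕ.^ n)) ⟩
      x ^ (p ℕ.* p ℕ.^ n) + y ^ (p ℕ.* p ℕ.^ n)        ∎

  -- Writing `N` as 1 plus an even number, 2 = 0 would give `N` times 1 = 1, although that multiple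
  -- is 0.
  odd⇒1+1≉0 : N ℕ.% 2 ≡ 1 → (1# + 1#) ≉0
  odd⇒1+1≉0 odd 2≈0 = 1≉0 (begin
    1#                                    ≈⟨ +-identityʳ 1# ⟨
    1# + 0#                               ≈⟨ +-congˡ (zeroʳ _) ⟨
    1# + (N ℕ./ 2) ×ᵣ 1# * 0#
      ≈⟨ +-congˡ (*-congˡ (trans (+-congˡ (+-identityʳ 1#)) 2≈0)) ⟨
    1# + (N ℕ./ 2) ×ᵣ 1# * (2 ×ᵣ 1#)      ≈⟨ +-congˡ (×1-homo-* (N ℕ./ 2) 2) ⟨
    (1 ℕ.+ N ℕ./ 2 ℕ.* 2) ×ᵣ 1#
      ≈⟨ ×-congˡ (≡.trans (m≡m%n+[m/n]*n N 2) (≡.cong (ℕ._+ N ℕ./ 2 ℕ.* 2) odd)) ⟨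
    N ×ᵣ 1#                               ≈⟨ cardinality×1≈0 ⟩
    0#                                    ∎)

-- The semilinear argument

module SemilinearForms {ℓ₁ ℓ₂ : Level} (F : Field ℓ₁ ℓ₂) where
  open Field F hiding (zero)
  open RingMorphisms rawRing rawRing
  open FieldProperties F
  open IntegerSolver commutativeRing
  open import Algebra.Properties.Ring ring using (-‿involutive; -0#≈0#)
  open import Algebra.Properties.AbelianGroup +-abelianGroup
    using () renaming (x∙y⁻¹≈ε⇒x≈y to x-y≈0⇒x≈y)
  open import Relation.Binary.Reasoning.Setoid setoid
  private
    :1 : ∀ {n} → Polynomial n
    :1 = con (+ 1)

  hom-≉0 : ∀ {f} → IsRingHomomorphism f → ∀ {x} → x ≉0 → f x ≉0
  hom-≉0 {f} f-hom {x} x≉0 fx≈0 = 1≉0 (begin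
    1#              ≈⟨ f.1#-homo ⟨
    f 1#            ≈⟨ f.⟦⟧-cong (inverse x x≉0) ⟨
    f (x * x ⁻¹)    ≈⟨ f.*-homo x (x ⁻¹) ⟩
    f x * f (x ⁻¹)  ≈⟨ *-congʳ fx≈0 ⟩
    0# * f (x ⁻¹)   ≈⟨ zeroˡ _ ⟩
    0#              ∎)
    where module f = IsRingHomomorphism f-hom

  hom-sub : ∀ {f} → IsRingHomomorphism f → ∀ x y → f (x - y) ≈ f x - f y
  hom-sub f-hom x y = trans (f.+-homo x (- y)) (+-congˡ (f.-‿homo y))
    where module f = IsRingHomomorphism f-hom

  -- The argument is carried out for abstract commuting ring endomorphisms. `σ-fixed⇒τ-fixed` serves
  -- to kill the mixed terms, `no-skew-unit` to exclude a vanishing factor in the diagonal, and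
  -- `h₀h₂≉1` makes the factors `g₀`, `g₋₁`, `g₋₂` invertible.
  module ScatteredCriterion
    (_≟_ : ∀ x y → Dec (x ≈ y)) (2≉0 : ¬ (1# + 1# ≈ 0#))
    {σ ρ τ : Carrier → Carrier}
    (σ-hom : IsRingHomomorphism σ) (ρ-hom : IsRingHomomorphism ρ) (τ-hom : IsRingHomomorphism τ)
    (σρ : ∀ x → σ (ρ x) ≈ x) (ρσ : ∀ x → ρ (σ x) ≈ x)
    (ττ : ∀ x → τ (τ x) ≈ x)
    (τσ : ∀ x → τ (σ x) ≈ σ (τ x)) (τρ : ∀ x → τ (ρ x) ≈ ρ (τ x))
    (σ-fixed⇒τ-fixed : ∀ {x} → σ x ≈ x → τ x ≈ x)
    (no-skew-unit : ∀ {x} → x * σ x ≈ - 1# → ¬ (τ x ≈ - x))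
    (h₀ : Carrier) (h₀τh₀ : h₀ * τ h₀ ≈ - 1#)
    (h₀h₂≉1 : ¬ (h₀ * σ (σ h₀) ≈ 1#))
    where

    private
      module σ = IsRingHomomorphism σ-hom
      module ρ = IsRingHomomorphism ρ-hom
      module τ = IsRingHomomorphism τ-hom

    -- For d, e ≠ 0 this is a line over the fixed field of τ (or 0).
    Twist : Carrier → Carrier → Carrier → Set ℓ₂
    Twist d e x = d * τ x ≈ e * x

    -- Rules for computing with twists

    twist-* : ∀ {d e x d′ e′ x′} → Twist d e x → Twist d′ e′ x′ → Twist (d * d′) (e * e′) (x * x′)
    twist-* {d} {e} {x} {d′} {e′} {x′} p q = begin
      d * d′ * τ (x * x′)      ≈⟨ *-congˡ (τ.*-homo x x′) ⟩
      d * d′ * (τ x * τ x′)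
        ≈⟨ solve 4 (λ a b c d → a :* b :* (c :* d) := a :* c :* (b :* d)) refl d d′ (τ x) (τ x′) ⟩
      d * τ x * (d′ * τ x′)    ≈⟨ *-cong p q ⟩
      e * x * (e′ * x′)
        ≈⟨ solve 4 (λ a b c d → a :* c :* (b :* d) := a :* b :* (c :* d)) refl e e′ x x′ ⟩
      e * e′ * (x * x′)        ∎

    twist-sub : ∀ {d e x x′} → Twist d e x → Twist d e x′ → Twist d e (x - x′)
    twist-sub {d} {e} {x} {x′} p q = begin
      d * τ (x - x′)         ≈⟨ *-congˡ (hom-sub τ-hom x x′) ⟩
      d * (τ x - τ x′)       ≈⟨ solve 3 (λ a b c → a :* (b :- c) := a :* b :- a :* c) refl d (τ x) (τ x′) ⟩
      d * τ x - d * τ x′     ≈⟨ +-cong p (-‿cong q) ⟩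
      e * x - e * x′         ≈⟨ solve 3 (λ a b c → a :* (b :- c) := a :* b :- a :* c) refl e x x′ ⟨
      e * (x - x′)           ∎

    twist-cong : ∀ {d d′ e e′ x x′} → d ≈ d′ → e ≈ e′ → x ≈ x′ → Twist d e x → Twist d′ e′ x′
    twist-cong d≈d′ e≈e′ x≈x′ p =
      trans (*-cong (sym d≈d′) (τ.⟦⟧-cong (sym x≈x′))) (trans p (*-cong e≈e′ x≈x′))

    -- Only the ratio of the two coefficients matters. Products of twists arrive with surplus
    -- factors, which are removed here.
    twist-cancel : ∀ k {d e d′ e′ x} → k ≉0 → d ≈ k * d′ → e ≈ k * e′ → Twist d e x → Twist d′ e′ x
    twist-cancel k k≉0 d≈ e≈ p = *-cancelˡ k≉0 (begin
      k * (_ * τ _)  ≈⟨ *-assoc _ _ _ ⟨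
      k * _ * τ _    ≈⟨ twist-cong d≈ e≈ refl p ⟩
      k * _ * _      ≈⟨ *-assoc _ _ _ ⟩
      k * (_ * _)    ∎)

    twist-hom : ∀ {f} → IsRingHomomorphism f → (∀ x → τ (f x) ≈ f (τ x)) →
                ∀ {d e x} → Twist d e x → Twist (f d) (f e) (f x)
    twist-hom {f} f-hom τf {d} {e} {x} p = begin
      f d * τ (f x)   ≈⟨ *-congˡ (τf x) ⟩
      f d * f (τ x)   ≈⟨ f.*-homo d (τ x) ⟨
      f (d * τ x)     ≈⟨ f.⟦⟧-cong p ⟩
      f (e * x)       ≈⟨ f.*-homo e x ⟩
      f e * f x       ∎
      where module f = IsRingHomomorphism f-hom

    -- Conjugates of h and their norms

    h₁ h₂ h₋₁ h₋₂ : Carrier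
    h₁  = σ h₀
    h₂  = σ h₁
    h₋₁ = ρ h₀
    h₋₂ = ρ h₋₁

    σh₋₁ : σ h₋₁ ≈ h₀
    σh₋₁ = σρ h₀

    σh₋₂ : σ h₋₂ ≈ h₋₁
    σh₋₂ = σρ h₋₁

    ρh₁ : ρ h₁ ≈ h₀
    ρh₁ = ρσ h₀

    ρh₂ : ρ h₂ ≈ h₁
    ρh₂ = ρσ h₁

    norm-hom : ∀ {f} → IsRingHomomorphism f → (∀ x → τ (f x) ≈ f (τ x)) →
               ∀ {x} → x * τ x ≈ - 1# → f x * τ (f x) ≈ - 1#
    norm-hom {f} f-hom τf {x} p = begin
      f x * τ (f x)  ≈⟨ *-congˡ (τf x) ⟩
      f x * f (τ x)  ≈⟨ f.*-homo x (τ x) ⟨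
      f (x * τ x)    ≈⟨ f.⟦⟧-cong p ⟩
      f (- 1#)       ≈⟨ f.-‿homo 1# ⟩
      - f 1#         ≈⟨ -‿cong f.1#-homo ⟩
      - 1#           ∎
      where module f = IsRingHomomorphism f-hom

    h₁τh₁ : h₁ * τ h₁ ≈ - 1#
    h₁τh₁ = norm-hom σ-hom τσ h₀τh₀

    h₂τh₂ : h₂ * τ h₂ ≈ - 1#
    h₂τh₂ = norm-hom σ-hom τσ h₁τh₁

    h₋₁τh₋₁ : h₋₁ * τ h₋₁ ≈ - 1#
    h₋₁τh₋₁ = norm-hom ρ-hom τρ h₀τh₀

    h₋₂τh₋₂ : h₋₂ * τ h₋₂ ≈ - 1#
    h₋₂τh₋₂ = norm-hom ρ-hom τρ h₋₁τh₋₁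

    norm-≉0 : ∀ {x} → x * τ x ≈ - 1# → x ≉0
    norm-≉0 {x} p x≈0 = 1≉0 (begin
      1#              ≈⟨ -‿involutive 1# ⟨
      - - 1#          ≈⟨ -‿cong p ⟨
      - (x * τ x)     ≈⟨ -‿cong (trans (*-congʳ x≈0) (zeroˡ _)) ⟩
      - 0#            ≈⟨ -0#≈0# ⟩
      0#              ∎)

    h₀≉0 : h₀ ≉0
    h₀≉0 = norm-≉0 h₀τh₀

    h₁≉0 : h₁ ≉0
    h₁≉0 = norm-≉0 h₁τh₁

    h₂≉0 : h₂ ≉0
    h₂≉0 = norm-≉0 h₂τh₂

    h₋₁≉0 : h₋₁ ≉0
    h₋₁≉0 = norm-≉0 h₋₁τh₋₁

    h₋₂≉0 : h₋₂ ≉0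
    h₋₂≉0 = norm-≉0 h₋₂τh₋₂

    twist-norm : ∀ {x} → x * τ x ≈ - 1# → Twist (x * x) (- 1#) x
    twist-norm {x} p = begin
      x * x * τ x    ≈⟨ *-assoc x x (τ x) ⟩
      x * (x * τ x)  ≈⟨ *-congˡ p ⟩
      x * - 1#       ≈⟨ *-comm x (- 1#) ⟩
      - 1# * x       ∎

    -- `τ` sends `x` to -1/x and `y` to -1/y; the signs cancel in the product, so `1# - x * y` goes
    -- to 1 - 1/(xy).
    twist-1-norms : ∀ {x y} → x * τ x ≈ - 1# → y * τ y ≈ - 1# → Twist (x * y) (- 1#) (1# - x * y)
    twist-1-norms {x} {y} p q = begin
      x * y * τ (1# - x * y)
        ≈⟨ *-congˡ (trans (hom-sub τ-hom 1# (x * y)) (+-cong τ.1#-homo (-‿cong (τ.*-homo x y)))) ⟩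
      x * y * (1# - τ x * τ y)
        ≈⟨ solve 4 (λ x y z w → x :* y :* (:1 :- z :* w) := x :* y :- x :* z :* (y :* w)) refl x y (τ x) (τ y) ⟩
      x * y - x * τ x * (y * τ y)
        ≈⟨ +-congˡ (-‿cong (*-cong p q)) ⟩
      x * y - - 1# * - 1#
        ≈⟨ solve 2 (λ x y → x :* y :- :- :1 :* :- :1 := :- :1 :* (:1 :- x :* y)) refl x y ⟩
      - 1# * (1# - x * y) ∎

    -- The invertible factors 1 - hᵢhᵢ₊₂

    g₀ g₋₁ g₋₂ : Carrier
    g₀  = 1# - h₀ * h₂
    g₋₁ = 1# - h₋₁ * h₁
    g₋₂ = 1# - h₋₂ * h₀

    hom-1-* : ∀ {f} → IsRingHomomorphism f → ∀ {x y x′ y′} → f x ≈ x′ → f y ≈ y′ →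
              f (1# - x * y) ≈ 1# - x′ * y′
    hom-1-* f-hom {x} {y} fx fy = trans (hom-sub f-hom 1# (x * y))
      (+-cong f.1#-homo (-‿cong (trans (f.*-homo x y) (*-cong fx fy))))
      where module f = IsRingHomomorphism f-hom

    ρg₀ : ρ g₀ ≈ g₋₁
    ρg₀ = hom-1-* ρ-hom refl ρh₂

    ρg₋₁ : ρ g₋₁ ≈ g₋₂
    ρg₋₁ = hom-1-* ρ-hom refl ρh₁

    σg₋₁ : σ g₋₁ ≈ g₀
    σg₋₁ = hom-1-* σ-hom σh₋₁ refl

    σg₋₂ : σ g₋₂ ≈ g₋₁
    σg₋₂ = hom-1-* σ-hom σh₋₂ refl

    g₀≉0 : g₀ ≉0
    g₀≉0 g₀≈0 = h₀h₂≉1 (sym (x-y≈0⇒x≈y _ _ g₀≈0))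

    g₋₁≉0 : g₋₁ ≉0
    g₋₁≉0 g₋₁≈0 = hom-≉0 ρ-hom g₀≉0 (trans ρg₀ g₋₁≈0)

    g₋₂≉0 : g₋₂ ≉0
    g₋₂≉0 g₋₂≈0 = hom-≉0 ρ-hom g₋₁≉0 (trans ρg₋₁ g₋₂≈0)

    twist-g₀ : Twist (h₀ * h₂) (- 1#) g₀
    twist-g₀ = twist-1-norms h₀τh₀ h₂τh₂

    twist-g₋₁ : Twist (h₋₁ * h₁) (- 1#) g₋₁
    twist-g₋₁ = twist-1-norms h₋₁τh₋₁ h₁τh₁

    twist-g₋₂ : Twist (h₋₂ * h₀) (- 1#) g₋₂
    twist-g₋₂ = twist-1-norms h₋₂τh₋₂ h₀τh₀

    -- The kernels of σ(x) + h₀h₁ τσ(x) and of τρ(x) + (h₀/h₋₁) ρ(x), the two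
    -- halves of ψ.
    Component₁ Component₂ : Carrier → Set ℓ₂
    Component₁ = Twist (h₀ * h₋₁) (- 1#)
    Component₂ = Twist h₀ (- h₁)

    σ-component₁ : ∀ {x} → Component₁ x → Twist (h₁ * h₀) (- 1#) (σ x)
    σ-component₁ p = twist-cong (trans (σ.*-homo h₀ h₋₁) (*-congˡ σh₋₁))
      (trans (σ.-‿homo 1#) (-‿cong σ.1#-homo)) refl (twist-hom σ-hom τσ p)

    ρ-component₁ : ∀ {x} → Component₁ x → Twist (h₋₁ * h₋₂) (- 1#) (ρ x)
    ρ-component₁ p = twist-cong (ρ.*-homo h₀ h₋₁)
      (trans (ρ.-‿homo 1#) (-‿cong ρ.1#-homo)) refl (twist-hom ρ-hom τρ p)

    σ-component₂ : ∀ {x} → Component₂ x → Twist h₁ (- h₂) (σ x)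
    σ-component₂ p = twist-cong refl (σ.-‿homo h₁) refl (twist-hom σ-hom τσ p)

    ρ-component₂ : ∀ {x} → Component₂ x → Twist h₋₁ (- h₀) (ρ x)
    ρ-component₂ p = twist-cong refl (trans (ρ.-‿homo h₁) (-‿cong ρh₁)) refl (twist-hom ρ-hom τρ p)

    -- The two components solve the linear system consisting of x = x₁ + x₂ and its `τ`-image h₀h₋₁
    -- τ(x) = -x₁ - h₋₁h₁ x₂. Its determinant is `g₋₁` up to sign; eliminating x₁ gives g₋₁x₂ =
    -- `Y₂`, and eliminating x₂ gives g₋₁x₁ = -h₋₁ `Y₁`.
    decompose : ∀ x → ∃₂ λ x₁ x₂ → x ≈ x₁ + x₂ × Component₁ x₁ × Component₂ x₂
    decompose x = - h₋₁ * (i * Y₁) , i * Y₂ , sum , component₁ , component₂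
      where
      i = g₋₁ ⁻¹
      Y₁ = h₀ * τ x + h₁ * x
      Y₂ = x + h₀ * h₋₁ * τ x

      twist-i : Twist 1# (- (h₋₁ * h₁)) i
      twist-i = *-cancelˡ g₋₁≉0 (begin
        g₋₁ * (1# * τ i)
          ≈⟨ solve 2 (λ g j → g :* (:1 :* j) := :- (:- :1 :* g :* j)) refl g₋₁ (τ i) ⟩
        - (- 1# * g₋₁ * τ i)                  ≈⟨ -‿cong (*-congʳ twist-g₋₁) ⟨
        - (h₋₁ * h₁ * τ g₋₁ * τ i)            ≈⟨ -‿cong (*-assoc _ _ _) ⟩
        - (h₋₁ * h₁ * (τ g₋₁ * τ i))          ≈⟨ -‿cong (*-congˡ (τ.*-homo g₋₁ i)) ⟨
        - (h₋₁ * h₁ * τ (g₋₁ * i))            ≈⟨ -‿cong (*-congˡ (τ.⟦⟧-cong (inverse g₋₁ g₋₁≉0))) ⟩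
        - (h₋₁ * h₁ * τ 1#)                   ≈⟨ -‿cong (*-congˡ τ.1#-homo) ⟩
        - (h₋₁ * h₁ * 1#)                     ≈⟨ -‿cong (*-congˡ (inverse g₋₁ g₋₁≉0)) ⟨
        - (h₋₁ * h₁ * (g₋₁ * i))
          ≈⟨ solve 3 (λ a g j → :- (a :* (g :* j)) := g :* (:- a :* j)) refl (h₋₁ * h₁) g₋₁ i ⟩
        g₋₁ * (- (h₋₁ * h₁) * i)              ∎)

      twist-Y₁ : Twist (h₀ * h₁) (- 1#) Y₁
      twist-Y₁ = begin
        h₀ * h₁ * τ Y₁
          ≈⟨ *-congˡ (trans (τ.+-homo _ _) (+-cong (trans (τ.*-homo _ _) (*-congˡ (ττ x))) (τ.*-homo _ _))) ⟩
        h₀ * h₁ * (τ h₀ * x + τ h₁ * τ x)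
          ≈⟨ solve 6 (λ a b c d x y → a :* b :* (c :* x :+ d :* y) := b :* (a :* c) :* x :+ a :* (b :* d) :* y)
               refl h₀ h₁ (τ h₀) (τ h₁) x (τ x) ⟩
        h₁ * (h₀ * τ h₀) * x + h₀ * (h₁ * τ h₁) * τ x
          ≈⟨ +-cong (*-congʳ (*-congˡ h₀τh₀)) (*-congʳ (*-congˡ h₁τh₁)) ⟩
        h₁ * - 1# * x + h₀ * - 1# * τ x
          ≈⟨ solve 4 (λ a b x y → b :* :- :1 :* x :+ a :* :- :1 :* y := :- :1 :* (a :* y :+ b :* x))
               refl h₀ h₁ x (τ x) ⟩
        - 1# * Y₁ ∎

      twist-Y₂ : Twist (h₀ * h₋₁) 1# Y₂
      twist-Y₂ = begin
        h₀ * h₋₁ * τ Y₂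
          ≈⟨ *-congˡ (trans (τ.+-homo _ _) (+-congˡ (trans (τ.*-homo _ _) (*-cong (τ.*-homo _ _) (ττ x))))) ⟩
        h₀ * h₋₁ * (τ x + τ h₀ * τ h₋₁ * x)
          ≈⟨ solve 6 (λ a b c d x y → a :* b :* (y :+ c :* d :* x) := a :* b :* y :+ a :* c :* (b :* d) :* x)
               refl h₀ h₋₁ (τ h₀) (τ h₋₁) x (τ x) ⟩
        h₀ * h₋₁ * τ x + h₀ * τ h₀ * (h₋₁ * τ h₋₁) * x
          ≈⟨ +-congˡ (*-congʳ (*-cong h₀τh₀ h₋₁τh₋₁)) ⟩
        h₀ * h₋₁ * τ x + - 1# * - 1# * x
          ≈⟨ solve 4 (λ a b x y → a :* b :* y :+ :- :1 :* :- :1 :* x := :1 :* (x :+ a :* b :* y))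
               refl h₀ h₋₁ x (τ x) ⟩
        1# * Y₂ ∎

      twist-neg : ∀ {d e z} → Twist d e z → Twist d e (- z)
      twist-neg {d} {e} {z} p = begin
        d * τ (- z)   ≈⟨ *-congˡ (τ.-‿homo z) ⟩
        d * - τ z     ≈⟨ solve 2 (λ d z → d :* :- z := :- (d :* z)) refl d (τ z) ⟩
        - (d * τ z)   ≈⟨ -‿cong p ⟩
        - (e * z)     ≈⟨ solve 2 (λ d z → d :* :- z := :- (d :* z)) refl e z ⟨
        e * - z       ∎

      component₁ : Component₁ (- h₋₁ * (i * Y₁))
      component₁ = twist-cancel (h₋₁ * h₁) (*-≉0 h₋₁≉0 h₁≉0)
        (solve 3 (λ a b c → c :* c :* (:1 :* (a :* b)) := c :* b :* (a :* c)) refl h₀ h₁ h₋₁)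
        (solve 2 (λ b c → :- :1 :* (:- (c :* b) :* :- :1) := c :* b :* :- :1) refl h₁ h₋₁)
        (twist-* (twist-neg (twist-norm h₋₁τh₋₁)) (twist-* twist-i twist-Y₁))

      component₂ : Component₂ (i * Y₂)
      component₂ = twist-cancel h₋₁ h₋₁≉0
        (solve 2 (λ a c → :1 :* (a :* c) := c :* a) refl h₀ h₋₁)
        (solve 2 (λ b c → :- (c :* b) :* :1 := c :* :- b) refl h₁ h₋₁)
        (twist-* twist-i twist-Y₂)

      sum : x ≈ - h₋₁ * (i * Y₁) + i * Y₂
      sum = begin
        x                ≈⟨ *-identityˡ x ⟨
        1# * x           ≈⟨ *-congʳ (inverse g₋₁ g₋₁≉0) ⟨
        g₋₁ * i * x
          ≈⟨ solve 6 (λ a b c i x y → (:1 :- c :* b) :* i :* x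
                := :- c :* (i :* (a :* y :+ b :* x)) :+ i :* (x :+ a :* c :* y))
               refl h₀ h₁ h₋₁ i x (τ x) ⟩
        - h₋₁ * (i * Y₁) + i * Y₂ ∎

    -- h₋₁ ψ(x), free of inverses because h₁ τ(h₁) = -1.
    cleared : Carrier → Carrier
    cleared x = h₋₁ * σ x + h₋₁ * τ (ρ x) + h₋₁ * (h₀ * h₁) * τ (σ x) + h₀ * ρ x

    -- The two terms in `σ x` and `τ (σ x)` cancel. The factor `h₋₂` is there so that the twist of
    -- `ρ x` can replace h₋₁h₋₂ τ(ρ(x)) by -ρ(x), which combines with h₀h₋₂ ρ(x) into `g₋₂`.
    cleared-component₁ : ∀ {x} → Component₁ x → h₋₂ * cleared x ≈ - (g₋₂ * ρ x)
    cleared-component₁ {x} p = begin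
      h₋₂ * cleared x
        ≈⟨ solve 8 (λ a b c d s r τs τr → d :* (c :* s :+ c :* τr :+ c :* (a :* b) :* τs :+ a :* r)
             := c :* d :* τr :+ (c :* d :* s :+ c :* d :* (b :* a :* τs)) :+ a :* d :* r)
             refl h₀ h₁ h₋₁ h₋₂ (σ x) (ρ x) (τ (σ x)) (τ (ρ x)) ⟩
      h₋₁ * h₋₂ * τ (ρ x) + (h₋₁ * h₋₂ * σ x + h₋₁ * h₋₂ * (h₁ * h₀ * τ (σ x))) + h₀ * h₋₂ * ρ x
        ≈⟨ +-congʳ (+-cong (ρ-component₁ p) (+-congˡ (*-congˡ (σ-component₁ p)))) ⟩
      - 1# * ρ x + (h₋₁ * h₋₂ * σ x + h₋₁ * h₋₂ * (- 1# * σ x)) + h₀ * h₋₂ * ρ x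
        ≈⟨ solve 5 (λ a c d s r → :- :1 :* r :+ (c :* d :* s :+ c :* d :* (:- :1 :* s)) :+ a :* d :* r
             := :- ((:1 :- d :* a) :* r))
             refl h₀ h₋₁ h₋₂ (σ x) (ρ x) ⟩
      - (g₋₂ * ρ x) ∎

    -- Here the terms in `ρ x` and `τ (ρ x)` cancel, and h₁ τ(σ(x)) = -h₂ σ(x) produces `g₀`.
    cleared-component₂ : ∀ {x} → Component₂ x → cleared x ≈ h₋₁ * g₀ * σ x
    cleared-component₂ {x} p = begin
      cleared x
        ≈⟨ solve 7 (λ a b c s r τs τr → c :* s :+ c :* τr :+ c :* (a :* b) :* τs :+ a :* r
             := c :* s :+ c :* a :* (b :* τs) :+ (c :* τr :+ a :* r))
             refl h₀ h₁ h₋₁ (σ x) (ρ x) (τ (σ x)) (τ (ρ x)) ⟩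
      h₋₁ * σ x + h₋₁ * h₀ * (h₁ * τ (σ x)) + (h₋₁ * τ (ρ x) + h₀ * ρ x)
        ≈⟨ +-cong (+-congˡ (*-congˡ (σ-component₂ p))) (+-congʳ (ρ-component₂ p)) ⟩
      h₋₁ * σ x + h₋₁ * h₀ * (- h₂ * σ x) + (- h₀ * ρ x + h₀ * ρ x)
        ≈⟨ solve 5 (λ a e c s r → c :* s :+ c :* a :* (:- e :* s) :+ (:- a :* r :+ a :* r)
             := c :* (:1 :- a :* e) :* s)
             refl h₀ h₂ h₋₁ (σ x) (ρ x) ⟩
      h₋₁ * g₀ * σ x ∎

    cleared-cong : ∀ {x y} → x ≈ y → cleared x ≈ cleared y
    cleared-cong x≈y = +-cong (+-cong (+-cong (*-congˡ (σ.⟦⟧-cong x≈y))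
      (*-congˡ (τ.⟦⟧-cong (ρ.⟦⟧-cong x≈y)))) (*-congˡ (τ.⟦⟧-cong (σ.⟦⟧-cong x≈y))))
      (*-congˡ (ρ.⟦⟧-cong x≈y))

    cleared-+ : ∀ x y → cleared (x + y) ≈ cleared x + cleared y
    cleared-+ x y = begin
      cleared (x + y)
        ≈⟨ +-cong (+-cong (+-cong (*-congˡ (σ.+-homo x y))
             (*-congˡ (trans (τ.⟦⟧-cong (ρ.+-homo x y)) (τ.+-homo _ _))))
             (*-congˡ (trans (τ.⟦⟧-cong (σ.+-homo x y)) (τ.+-homo _ _))))
             (*-congˡ (ρ.+-homo x y)) ⟩
      h₋₁ * (σ x + σ y) + h₋₁ * (τ (ρ x) + τ (ρ y)) + h₋₁ * (h₀ * h₁) * (τ (σ x) + τ (σ y)) + h₀ * (ρ x + ρ y)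
        ≈⟨ solve 11 (λ c d e s s′ r r′ t t′ u u′ →
               c :* (s :+ s′) :+ c :* (t :+ t′) :+ d :* (u :+ u′) :+ e :* (r :+ r′)
               := (c :* s :+ c :* t :+ d :* u :+ e :* r) :+ (c :* s′ :+ c :* t′ :+ d :* u′ :+ e :* r′))
             refl h₋₁ (h₋₁ * (h₀ * h₁)) h₀ (σ x) (σ y) (ρ x) (ρ y) (τ (ρ x)) (τ (ρ y)) (τ (σ x)) (τ (σ y)) ⟩
      cleared x + cleared y ∎

    cleared-components : ∀ {x x₁ x₂} → x ≈ x₁ + x₂ → Component₁ x₁ → Component₂ x₂ →
      h₋₂ * cleared x ≈ h₋₁ * h₋₂ * g₀ * σ x₂ - g₋₂ * ρ x₁
    cleared-components {x} {x₁} {x₂} x≈ p₁ p₂ = begin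
      h₋₂ * cleared x                           ≈⟨ *-congˡ (trans (cleared-cong x≈) (cleared-+ x₁ x₂)) ⟩
      h₋₂ * (cleared x₁ + cleared x₂)           ≈⟨ distribˡ _ _ _ ⟩
      h₋₂ * cleared x₁ + h₋₂ * cleared x₂
        ≈⟨ +-cong (cleared-component₁ p₁) (*-congˡ (cleared-component₂ p₂)) ⟩
      - (g₋₂ * ρ x₁) + h₋₂ * (h₋₁ * g₀ * σ x₂)
        ≈⟨ solve 5 (λ c d g s r → :- r :+ d :* (c :* g :* s) := c :* d :* g :* s :- r)
             refl h₋₁ h₋₂ g₀ (σ x₂) (g₋₂ * ρ x₁) ⟩
      h₋₁ * h₋₂ * g₀ * σ x₂ - g₋₂ * ρ x₁        ∎

    -- Diagonal and mixed parts of the antisymmetric form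

    module _ {x₁ x₂ y₁ y₂ : Carrier}
      (cx₁ : Component₁ x₁) (cx₂ : Component₂ x₂) (cy₁ : Component₁ y₁) (cy₂ : Component₂ y₂)
      where

      cross mixed₁ mixed₂ diagonal : Carrier
      cross    = σ x₂ * y₁ - σ y₂ * x₁
      mixed₁   = g₋₂ * ρ cross
      mixed₂   = h₋₁ * h₋₂ * g₀ * cross
      diagonal = h₋₁ * h₋₂ * g₀ * (σ x₂ * y₂ - σ y₂ * x₂) - g₋₂ * (ρ x₁ * y₁ - ρ y₁ * x₁)

      -- Because `ρ` undoes `σ`, the second mixed expression is the `ρ`-image of the first. Both
      -- mixed terms therefore depend on the single unknown `cross`.
      ρ-cross : ρ cross ≈ x₂ * ρ y₁ - y₂ * ρ x₁
      ρ-cross = trans (hom-sub ρ-hom _ _) (+-cong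
        (trans (ρ.*-homo _ _) (*-congʳ (ρσ x₂)))
        (-‿cong (trans (ρ.*-homo _ _) (*-congʳ (ρσ y₂)))))

      expand : (h₋₁ * h₋₂ * g₀ * σ x₂ - g₋₂ * ρ x₁) * (y₁ + y₂)
             - (h₋₁ * h₋₂ * g₀ * σ y₂ - g₋₂ * ρ y₁) * (x₁ + x₂)
             ≈ diagonal + mixed₂ + mixed₁
      expand = begin
        (h₋₁ * h₋₂ * g₀ * σ x₂ - g₋₂ * ρ x₁) * (y₁ + y₂)
          - (h₋₁ * h₋₂ * g₀ * σ y₂ - g₋₂ * ρ y₁) * (x₁ + x₂)
          ≈⟨ solve 10 (λ k l s r y₁ y₂ s′ r′ x₁ x₂ →
               (k :* s :- l :* r) :* (y₁ :+ y₂) :- (k :* s′ :- l :* r′) :* (x₁ :+ x₂)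
               := k :* (s :* y₂ :- s′ :* x₂) :- l :* (r :* y₁ :- r′ :* x₁)
                  :+ k :* (s :* y₁ :- s′ :* x₁) :+ l :* (x₂ :* r′ :- y₂ :* r))
               refl (h₋₁ * h₋₂ * g₀) g₋₂ (σ x₂) (ρ x₁) y₁ y₂ (σ y₂) (ρ y₁) x₁ x₂ ⟩
        diagonal + mixed₂ + g₋₂ * (x₂ * ρ y₁ - y₂ * ρ x₁)
          ≈⟨ +-congˡ (*-congˡ ρ-cross) ⟨
        diagonal + mixed₂ + mixed₁ ∎
  
      private
        -- The map x ↦ D τ(x) multiplies `diagonal` by -1, `mixed₁` by -m and `mixed₂` by -1/m. The
        -- multipliers of the mixed terms differ from that of the diagonal because 1 - m is `g₋₁`,
        -- which is nonzero.
        D = h₀ * h₀ * (h₋₁ * h₋₁) * (h₋₂ * h₋₂)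
        m = h₋₁ * h₁

        twist-scale : Twist (h₋₁ * h₋₁ * (h₋₂ * h₋₂) * (h₀ * h₂)) (- 1# * - 1# * - 1#) (h₋₁ * h₋₂ * g₀)
        twist-scale = twist-* (twist-* (twist-norm h₋₁τh₋₁) (twist-norm h₋₂τh₋₂)) twist-g₀

      twist-cross : Twist (h₁ * (h₀ * h₋₁)) h₂ cross
      twist-cross = twist-cong refl (solve 1 (λ e → :- e :* :- :1 := e) refl h₂) refl
        (twist-sub (twist-* (σ-component₂ cx₂) cy₁) (twist-* (σ-component₂ cy₂) cx₁))
  
      twist-diagonal : Twist D (- 1#) diagonal
      twist-diagonal = twist-sub
        (twist-cancel (h₁ * h₂) (*-≉0 h₁≉0 h₂≉0)
          (solve 5 (λ a b c d e → c :* c :* (d :* d) :* (a :* e) :* (b :* a)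
               := b :* e :* (a :* a :* (c :* c) :* (d :* d))) refl h₀ h₁ h₋₁ h₋₂ h₂)
          (solve 2 (λ b e → :- :1 :* :- :1 :* :- :1 :* (:- e :* :- b) := b :* e :* :- :1) refl h₁ h₂)
          (twist-* twist-scale
            (twist-sub (twist-* (σ-component₂ cx₂) cy₂) (twist-* (σ-component₂ cy₂) cx₂))))
        (twist-cong
          (solve 3 (λ a c d → d :* a :* (c :* d :* (a :* c)) := a :* a :* (c :* c) :* (d :* d)) refl h₀ h₋₁ h₋₂)
          (solve 0 (:- :1 :* (:- :1 :* :- :1) := :- :1) refl)
          refl
          (twist-* twist-g₋₂
            (twist-sub (twist-* (ρ-component₁ cx₁) cy₁) (twist-* (ρ-component₁ cy₁) cx₁))))
  
      twist-mixed₂ : Twist (D * m) (- 1#) mixed₂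
      twist-mixed₂ = twist-cancel h₂ h₂≉0
        (solve 5 (λ a b c d e → c :* c :* (d :* d) :* (a :* e) :* (b :* (a :* c))
             := e :* (a :* a :* (c :* c) :* (d :* d) :* (c :* b))) refl h₀ h₁ h₋₁ h₋₂ h₂)
        (solve 1 (λ e → :- :1 :* :- :1 :* :- :1 :* e := e :* :- :1) refl h₂)
        (twist-* twist-scale twist-cross)
  
      twist-mixed₁ : Twist D (- m) mixed₁
      twist-mixed₁ = begin
        D * τ mixed₁
          ≈⟨ solve 4 (λ a c d t → a :* a :* (c :* c) :* (d :* d) :* t := c :* (d :* a :* (a :* (c :* d)) :* t))
               refl h₀ h₋₁ h₋₂ (τ mixed₁) ⟩
        h₋₁ * (h₋₂ * h₀ * (h₀ * (h₋₁ * h₋₂)) * τ mixed₁)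
          ≈⟨ *-congˡ (twist-* twist-g₋₂ ρ-twist-cross) ⟩
        h₋₁ * (- 1# * h₁ * mixed₁)
          ≈⟨ solve 3 (λ b c t → c :* (:- :1 :* b :* t) := :- (c :* b) :* t) refl h₁ h₋₁ mixed₁ ⟩
        - m * mixed₁ ∎
        where
        ρ-twist-cross : Twist (h₀ * (h₋₁ * h₋₂)) h₁ (ρ cross)
        ρ-twist-cross = twist-cong
          (trans (ρ.*-homo _ _) (*-cong ρh₁ (ρ.*-homo _ _))) ρh₂ refl (twist-hom ρ-hom τρ twist-cross)

      module _ (sum≈0 : diagonal + mixed₂ + mixed₁ ≈ 0#) where

        -- Eliminate the diagonal between the vanishing sum and its τ-image.
        mixed-relation : mixed₂ ≈ m * mixed₁
        mixed-relation = x-y≈0⇒x≈y _ _ (*-zero-right g₋₁≉0 (begin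
          g₋₁ * (mixed₂ - m * mixed₁)
            ≈⟨ solve 5 (λ P A B c b → (:1 :- c :* b) :* (A :- c :* b :* B)
                 := :- (c :* b :* (:- :1 :* P) :+ :- :1 :* A :+ c :* b :* (:- (c :* b) :* B) :+ c :* b :* (P :+ A :+ B)))
                 refl diagonal mixed₂ mixed₁ h₋₁ h₁ ⟩
          - (m * (- 1# * diagonal) + - 1# * mixed₂ + m * (- m * mixed₁) + m * (diagonal + mixed₂ + mixed₁))
            ≈⟨ -‿cong (+-congʳ (+-cong (+-cong (*-congˡ twist-diagonal) twist-mixed₂) (*-congˡ twist-mixed₁))) ⟨
          - (m * (D * τ diagonal) + D * m * τ mixed₂ + m * (D * τ mixed₁) + m * (diagonal + mixed₂ + mixed₁))
            ≈⟨ solve 6 (λ P A B D m S → :- (m :* (D :* P) :+ D :* m :* A :+ m :* (D :* B) :+ m :* S)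
                 := :- (D :* m :* (P :+ A :+ B) :+ m :* S))
                 refl (τ diagonal) (τ mixed₂) (τ mixed₁) D m (diagonal + mixed₂ + mixed₁) ⟩
          - (D * m * (τ diagonal + τ mixed₂ + τ mixed₁) + m * (diagonal + mixed₂ + mixed₁))
            ≈⟨ -‿cong (+-congʳ (*-congˡ (trans (τ.+-homo _ _) (+-congʳ (τ.+-homo _ _))))) ⟨
          - (D * m * τ (diagonal + mixed₂ + mixed₁) + m * (diagonal + mixed₂ + mixed₁))
            ≈⟨ -‿cong (+-cong (*-congˡ (trans (τ.⟦⟧-cong sum≈0) τ.0#-homo)) (*-congˡ sum≈0)) ⟩
          - (D * m * 0# + m * 0#)
            ≈⟨ solve 2 (λ D m → :- (D :* m :* con (+ 0) :+ m :* con (+ 0)) := con (+ 0)) refl D m ⟩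
          0# ∎))

        private
          -- `n` telescopes the relation h₋₂ z = h₁ ρ(z): since ρ(n) = h₀h₋₁h₋₂, passing from `n` to
          -- its `ρ`-image trades h₁ for h₋₂, and the quotient `w` of `z` by `n` becomes fixed.
          z n w : Carrier
          z = g₀ * g₋₁ * cross
          n = h₁ * (h₀ * h₋₁)
          w = n ⁻¹ * z

        n≉0 : n ≉0
        n≉0 = *-≉0 h₁≉0 (*-≉0 h₀≉0 h₋₁≉0)

        nw≈z : n * w ≈ z
        nw≈z = trans (sym (*-assoc _ _ _)) (trans (*-congʳ (inverse n n≉0)) (*-identityˡ z))

        -- Multiplying `mixed-relation` by `g₋₁` completes `cross` to `z` on the left and `ρ cross`
        -- to `ρ z` on the right, as `ρ` sends g₀g₋₁ to g₋₁g₋₂.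
        σ-relation : h₋₂ * z ≈ h₁ * ρ z
        σ-relation = *-cancelˡ h₋₁≉0 (begin
          h₋₁ * (h₋₂ * z)
            ≈⟨ solve 5 (λ c d g g′ u → c :* (d :* (g :* g′ :* u)) := g′ :* (c :* d :* g :* u))
                 refl h₋₁ h₋₂ g₀ g₋₁ cross ⟩
          g₋₁ * mixed₂                         ≈⟨ *-congˡ mixed-relation ⟩
          g₋₁ * (m * (g₋₂ * ρ cross))
            ≈⟨ solve 5 (λ c b g g′ u → g :* (c :* b :* (g′ :* u)) := c :* (b :* (g :* g′ :* u)))
                 refl h₋₁ h₁ g₋₁ g₋₂ (ρ cross) ⟩
          h₋₁ * (h₁ * (g₋₁ * g₋₂ * ρ cross))
            ≈⟨ *-congˡ (*-congˡ (*-congʳ (trans (ρ.*-homo _ _) (*-cong ρg₀ ρg₋₁)))) ⟨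
          h₋₁ * (h₁ * (ρ (g₀ * g₋₁) * ρ cross)) ≈⟨ *-congˡ (*-congˡ (ρ.*-homo _ _)) ⟨
          h₋₁ * (h₁ * ρ z)                     ∎)

        ρw≈w : ρ w ≈ w
        ρw≈w = *-cancelˡ (*-≉0 h₁≉0 (*-≉0 h₀≉0 (*-≉0 h₋₁≉0 h₋₂≉0))) (begin
          h₁ * (h₀ * (h₋₁ * h₋₂)) * ρ w   ≈⟨ *-assoc _ _ _ ⟩
          h₁ * (h₀ * (h₋₁ * h₋₂) * ρ w)
            ≈⟨ *-congˡ (*-congʳ (trans (ρ.*-homo _ _) (*-cong ρh₁ (ρ.*-homo _ _)))) ⟨
          h₁ * (ρ n * ρ w)                ≈⟨ *-congˡ (ρ.*-homo _ _) ⟨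
          h₁ * ρ (n * w)                  ≈⟨ *-congˡ (ρ.⟦⟧-cong nw≈z) ⟩
          h₁ * ρ z                        ≈⟨ σ-relation ⟨
          h₋₂ * z                         ≈⟨ *-congˡ nw≈z ⟨
          h₋₂ * (n * w)
            ≈⟨ solve 5 (λ a b c d w → d :* (b :* (a :* c) :* w) := b :* (a :* (c :* d)) :* w) refl h₀ h₁ h₋₁ h₋₂ w ⟩
          h₁ * (h₀ * (h₋₁ * h₋₂)) * w     ∎)

        τw≈w : τ w ≈ w
        τw≈w = σ-fixed⇒τ-fixed (trans (σ.⟦⟧-cong (sym ρw≈w)) (σρ w))

        τz≈τnw : τ z ≈ τ n * w
        τz≈τnw = trans (τ.⟦⟧-cong (sym nw≈z)) (trans (τ.*-homo n w) (*-congˡ τw≈w))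

        nτn≈-1 : n * τ n ≈ - 1#
        nτn≈-1 = begin
          n * τ n      ≈⟨ *-congˡ (trans (τ.*-homo _ _) (*-congˡ (τ.*-homo _ _))) ⟩
          n * (τ h₁ * (τ h₀ * τ h₋₁))
            ≈⟨ solve 6 (λ a b c x y z → a :* (b :* c) :* (x :* (y :* z)) := a :* x :* (b :* y :* (c :* z)))
                 refl h₁ h₀ h₋₁ (τ h₁) (τ h₀) (τ h₋₁) ⟩
          h₁ * τ h₁ * (h₀ * τ h₀ * (h₋₁ * τ h₋₁))   ≈⟨ *-cong h₁τh₁ (*-cong h₀τh₀ h₋₁τh₋₁) ⟩
          - 1# * (- 1# * - 1#)                      ≈⟨ solve 0 (:- :1 :* (:- :1 :* :- :1) := :- :1) refl ⟩
          - 1# ∎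

        twist-z : Twist (n * n) 1# z
        twist-z = twist-cancel h₂ h₂≉0
          (solve 4 (λ a b c e → a :* e :* (c :* b) :* (b :* (a :* c)) := e :* (b :* (a :* c) :* (b :* (a :* c))))
            refl h₀ h₁ h₋₁ h₂)
          (solve 1 (λ e → :- :1 :* :- :1 :* e := e :* :1) refl h₂)
          (twist-* (twist-* twist-g₀ twist-g₋₁) twist-cross)

        -- Since `w` is fixed by `τ` and n τ(n) = -1, n² τ(z) = n² τ(n) w = -n w = -z. The twist of
        -- `z` gives n² τ(z) = z instead, so 2z = 0.
        z≈0 : z ≈ 0#
        z≈0 = *-zero-right 2≉0 (begin
          (1# + 1#) * z         ≈⟨ solve 1 (λ z → (:1 :+ :1) :* z := :1 :* z :+ z) refl z ⟩
          1# * z + z            ≈⟨ +-cong (sym twist-z) (sym nw≈z) ⟩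
          n * n * τ z + n * w   ≈⟨ +-congʳ (*-congˡ τz≈τnw) ⟩
          n * n * (τ n * w) + n * w
            ≈⟨ solve 3 (λ n t w → n :* n :* (t :* w) :+ n :* w := n :* (n :* t) :* w :+ n :* w) refl n (τ n) w ⟩
          n * (n * τ n) * w + n * w     ≈⟨ +-congʳ (*-congʳ (*-congˡ nτn≈-1)) ⟩
          n * - 1# * w + n * w
            ≈⟨ solve 2 (λ n w → n :* :- :1 :* w :+ n :* w := con (+ 0)) refl n w ⟩
          0# ∎)

        cross≈0 : cross ≈ 0#
        cross≈0 = *-zero-right (*-≉0 g₀≉0 g₋₁≉0) z≈0

        diagonal≈0 : diagonal ≈ 0#
        diagonal≈0 = begin
          diagonal            ≈⟨ solve 1 (λ x → x := x :+ con (+ 0) :+ con (+ 0)) refl diagonal ⟩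
          diagonal + 0# + 0#
            ≈⟨ +-cong (+-congˡ (trans (*-congˡ cross≈0) (zeroʳ _)))
                 (trans (*-congˡ (trans (ρ.⟦⟧-cong cross≈0) ρ.0#-homo)) (zeroʳ _)) ⟨
          diagonal + mixed₂ + mixed₁      ≈⟨ sum≈0 ⟩
          0# ∎

    -- If the inequality failed, v = g₋₂ ρ(x₁) / (x₂ g₋₁ h₋₂) would satisfy
    -- v σ(v) = -1 and τ(v) = -v.
    norms-differ : ∀ {x₁ x₂} → Component₁ x₁ → Component₂ x₂ → x₂ ≉0 →
      (h₋₁ * h₋₂ * g₀ * (σ x₂ * x₂) + g₋₂ * (ρ x₁ * x₁)) ≉0
    norms-differ {x₁} {x₂} cx₁ cx₂ x₂≉0 sum≈0 = no-skew-unit vσv≈-1 τv≈-v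
      where
      N = ρ x₁ * g₋₂
      -- In N σ(N) and E σ(E) the factor `g₋₁` is common. What remains is g₋₂ ρ(x₁) x₁ and h₋₁h₋₂g₀
      -- σ(x₂) x₂, the two summands assumed to add up to 0.
      E = x₂ * g₋₁ * h₋₂
      v = E ⁻¹ * N
      -- The same coefficient serves both: K τ(N) = N and K τ(E) = -E, so `τ` negates the quotient
      -- `v`.
      K = h₀ * h₋₁ * (h₋₂ * h₋₂)

      E≉0 : E ≉0
      E≉0 = *-≉0 (*-≉0 x₂≉0 g₋₁≉0) h₋₂≉0

      Ev≈N : E * v ≈ N
      Ev≈N = trans (sym (*-assoc _ _ _)) (trans (*-congʳ (inverse E E≉0)) (*-identityˡ N))

      σE : σ E ≈ σ x₂ * g₀ * h₋₁
      σE = trans (σ.*-homo _ _) (*-cong (trans (σ.*-homo _ _) (*-congˡ σg₋₁)) σh₋₂)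

      σN : σ N ≈ x₁ * g₋₁
      σN = trans (σ.*-homo _ _) (*-cong (σρ x₁) σg₋₂)

      vσv≈-1 : v * σ v ≈ - 1#
      vσv≈-1 = *-cancelˡ (*-≉0 E≉0 (hom-≉0 σ-hom E≉0)) (begin
        E * σ E * (v * σ v)
          ≈⟨ solve 4 (λ a b c d → a :* b :* (c :* d) := a :* c :* (b :* d)) refl E (σ E) v (σ v) ⟩
        E * v * (σ E * σ v)
          ≈⟨ *-cong Ev≈N (trans (sym (σ.*-homo _ _)) (trans (σ.⟦⟧-cong Ev≈N) σN)) ⟩
        N * (x₁ * g₋₁)
          ≈⟨ solve 6 (λ r g x g′ k s → r :* g :* (x :* g′) := g′ :* (k :* s :+ g :* (r :* x)) :- g′ :* (k :* s))
               refl (ρ x₁) g₋₂ x₁ g₋₁ (h₋₁ * h₋₂ * g₀) (σ x₂ * x₂) ⟩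
        g₋₁ * (h₋₁ * h₋₂ * g₀ * (σ x₂ * x₂) + g₋₂ * (ρ x₁ * x₁)) - g₋₁ * (h₋₁ * h₋₂ * g₀ * (σ x₂ * x₂))
          ≈⟨ +-congʳ (*-congˡ sum≈0) ⟩
        g₋₁ * 0# - g₋₁ * (h₋₁ * h₋₂ * g₀ * (σ x₂ * x₂))
          ≈⟨ solve 6 (λ g′ c d g s x → g′ :* con (+ 0) :- g′ :* (c :* d :* g :* (s :* x))
               := x :* g′ :* d :* (s :* g :* c) :* :- :1) refl g₋₁ h₋₁ h₋₂ g₀ (σ x₂) x₂ ⟩
        E * (σ x₂ * g₀ * h₋₁) * - 1#   ≈⟨ *-congʳ (*-congˡ σE) ⟨
        E * σ E * - 1# ∎)

      twist-N : Twist K 1# N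
      twist-N = twist-cong
        (solve 3 (λ a c d → c :* d :* (d :* a) := a :* c :* (d :* d)) refl h₀ h₋₁ h₋₂)
        (solve 0 (:- :1 :* :- :1 := :1) refl) refl
        (twist-* (ρ-component₁ cx₁) twist-g₋₂)

      twist-E : Twist K (- 1#) E
      twist-E = twist-cancel h₁ h₁≉0
        (solve 4 (λ a b c d → a :* (c :* b) :* (d :* d) := b :* (a :* c :* (d :* d))) refl h₀ h₁ h₋₁ h₋₂)
        (solve 1 (λ b → :- b :* :- :1 :* :- :1 := b :* :- :1) refl h₁)
        (twist-* (twist-* cx₂ twist-g₋₁) (twist-norm h₋₂τh₋₂))

      τv≈-v : τ v ≈ - v
      τv≈-v = *-cancelˡ E≉0 (begin
        E * τ v               ≈⟨ solve 2 (λ E v → E :* v := :- (:- :1 :* E :* v)) refl E (τ v) ⟩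
        - (- 1# * E * τ v)    ≈⟨ -‿cong (*-congʳ twist-E) ⟨
        - (K * τ E * τ v)     ≈⟨ -‿cong (trans (*-assoc _ _ _) (*-congˡ (sym (τ.*-homo _ _)))) ⟩
        - (K * τ (E * v))     ≈⟨ -‿cong (*-congˡ (τ.⟦⟧-cong Ev≈N)) ⟩
        - (K * τ N)           ≈⟨ -‿cong twist-N ⟩
        - (1# * N)            ≈⟨ -‿cong (*-congˡ Ev≈N) ⟨
        - (1# * (E * v))      ≈⟨ solve 2 (λ E v → :- (:1 :* (E :* v)) := E :* :- v) refl E v ⟩
        E * - v               ∎)

    -- From the eigenvalue equation to a fixed ratio

    module _ {x γ : Carrier} (x≉0 : x ≉0) (eigen : cleared (γ * x) ≈ γ * cleared x) where

      -- The sum is `h₋₂` times the determinant of the pairs (`cleared x`, `x`) and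
      -- (`cleared (γ * x)`, `γ * x`), which `eigen` makes proportional.
      components-annihilate : ∀ {x₁ x₂ y₁ y₂} → x ≈ x₁ + x₂ → γ * x ≈ y₁ + y₂ →
        (cx₁ : Component₁ x₁) (cx₂ : Component₂ x₂) (cy₁ : Component₁ y₁) (cy₂ : Component₂ y₂) →
        diagonal cx₁ cx₂ cy₁ cy₂ + mixed₂ cx₁ cx₂ cy₁ cy₂ + mixed₁ cx₁ cx₂ cy₁ cy₂ ≈ 0#
      components-annihilate {x₁} {x₂} {y₁} {y₂} x≈ y≈ cx₁ cx₂ cy₁ cy₂ = begin
        diagonal cx₁ cx₂ cy₁ cy₂ + mixed₂ cx₁ cx₂ cy₁ cy₂ + mixed₁ cx₁ cx₂ cy₁ cy₂
          ≈⟨ expand cx₁ cx₂ cy₁ cy₂ ⟨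
        (h₋₁ * h₋₂ * g₀ * σ x₂ - g₋₂ * ρ x₁) * (y₁ + y₂)
          - (h₋₁ * h₋₂ * g₀ * σ y₂ - g₋₂ * ρ y₁) * (x₁ + x₂)
          ≈⟨ +-cong (*-cong (cleared-components x≈ cx₁ cx₂) y≈)
               (-‿cong (*-cong (cleared-components y≈ cy₁ cy₂) x≈)) ⟨
        h₋₂ * cleared x * (γ * x) - h₋₂ * cleared (γ * x) * x
          ≈⟨ +-congˡ (-‿cong (*-congʳ (*-congˡ eigen))) ⟩
        h₋₂ * cleared x * (γ * x) - h₋₂ * (γ * cleared x) * x
          ≈⟨ solve 4 (λ d c γ x → d :* c :* (γ :* x) :- d :* (γ :* c) :* x := con (+ 0))
               refl h₋₂ (cleared x) γ x ⟩
        0# ∎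

      ratio-fixed : ∀ {β x₁ x₂ y₁ y₂} → σ β ≈ β → x ≈ x₁ + x₂ → γ * x ≈ y₁ + y₂ →
                    y₁ ≈ β * x₁ → y₂ ≈ β * x₂ → σ γ ≈ γ
      ratio-fixed {β} {x₁} {x₂} {y₁} {y₂} σβ≈β x≈ y≈ y₁≈ y₂≈ =
        trans (σ.⟦⟧-cong γ≈β) (trans σβ≈β (sym γ≈β))
        where
        γ≈β : γ ≈ β
        γ≈β = *-cancelˡ x≉0 (begin
          x * γ              ≈⟨ *-comm x γ ⟩
          γ * x              ≈⟨ y≈ ⟩
          y₁ + y₂            ≈⟨ +-cong y₁≈ y₂≈ ⟩
          β * x₁ + β * x₂    ≈⟨ distribˡ β x₁ x₂ ⟨
          β * (x₁ + x₂)      ≈⟨ *-congˡ x≈ ⟨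
          β * x              ≈⟨ *-comm β x ⟩
          x * β              ∎)

      module _ {x₁ x₂ y₁ y₂ : Carrier} (x≈ : x ≈ x₁ + x₂) (y≈ : γ * x ≈ y₁ + y₂)
        (cx₁ : Component₁ x₁) (cx₂ : Component₂ x₂)
        (cross≈0 : σ x₂ * y₁ - σ y₂ * x₁ ≈ 0#)
        (diagonal≈0 : h₋₁ * h₋₂ * g₀ * (σ x₂ * y₂ - σ y₂ * x₂) - g₋₂ * (ρ x₁ * y₁ - ρ y₁ * x₁) ≈ 0#)
        where

        private
          k = h₋₁ * h₋₂ * g₀

          k≉0 : k ≉0
          k≉0 = *-≉0 (*-≉0 h₋₁≉0 h₋₂≉0) g₀≉0

          divide : ∀ {a} b → a ≉0 → b ≈ b * a ⁻¹ * a
          divide {a} b a≉0 = sym (trans (*-assoc _ _ _)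
            (trans (*-congˡ (trans (*-comm _ _) (inverse a a≉0))) (*-identityʳ b)))

        -- Then x₁ is nonzero, so the cross relation forces y₂ = 0. The diagonal relation reduces to
        -- g₋₂ (ρ(x₁) y₁ - ρ(y₁) x₁) = 0, which says that y₁/x₁ is fixed by `ρ`.
        fixed-if-x₂≈0 : x₂ ≈ 0# → σ γ ≈ γ
        fixed-if-x₂≈0 x₂≈0 = ratio-fixed σα≈α x≈ y≈ y₁≈ (trans y₂≈0 (sym (trans (*-congˡ x₂≈0) (zeroʳ α))))
          where
          x₁≉0 : x₁ ≉0
          x₁≉0 x₁≈0 = x≉0 (trans x≈ (trans (+-cong x₁≈0 x₂≈0) (+-identityˡ 0#)))
          σx₂≈0 : σ x₂ ≈ 0#
          σx₂≈0 = trans (σ.⟦⟧-cong x₂≈0) σ.0#-homo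
          y₂≈0 : y₂ ≈ 0#
          y₂≈0 with y₂ ≟ 0#
          ... | yes eq = eq
          ... | no neq = contradiction (begin
            σ y₂ * x₁      ≈⟨ x-y≈0⇒x≈y _ _ cross≈0 ⟨
            σ x₂ * y₁      ≈⟨ *-congʳ σx₂≈0 ⟩
            0# * y₁        ≈⟨ zeroˡ y₁ ⟩
            0#             ∎) (*-≉0 (hom-≉0 σ-hom neq) x₁≉0)
          α = y₁ * x₁ ⁻¹
          y₁≈ : y₁ ≈ α * x₁
          y₁≈ = divide y₁ x₁≉0
          α≈ρα : α ≈ ρ α
          α≈ρα = *-cancelˡ (*-≉0 g₋₂≉0 (*-≉0 (hom-≉0 ρ-hom x₁≉0) x₁≉0)) (sym (x-y≈0⇒x≈y _ _ (begin
            g₋₂ * (ρ x₁ * x₁) * ρ α - g₋₂ * (ρ x₁ * x₁) * α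
              -- The variables `S` and `S′` stand for `y₂` and `σ y₂`; multiplied by 0, they restore
              -- the vanished summand so that `diagonal≈0` applies verbatim.
              ≈⟨ solve 8 (λ g r x a s k S S′ → g :* (r :* x) :* s :- g :* (r :* x) :* a
                   := k :* (con (+ 0) :* S :- S′ :* con (+ 0)) :- g :* (r :* (a :* x) :- s :* r :* x))
                   refl g₋₂ (ρ x₁) x₁ α (ρ α) k y₂ (σ y₂) ⟩
            k * (0# * y₂ - σ y₂ * 0#) - g₋₂ * (ρ x₁ * (α * x₁) - ρ α * ρ x₁ * x₁)
              ≈⟨ +-cong (*-congˡ (+-cong (*-congʳ σx₂≈0) (-‿cong (*-congˡ x₂≈0))))
                   (-‿cong (*-congˡ (+-cong (*-congˡ y₁≈)
                     (-‿cong (*-congʳ (trans (ρ.⟦⟧-cong y₁≈) (ρ.*-homo _ _))))))) ⟨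
            k * (σ x₂ * y₂ - σ y₂ * x₂) - g₋₂ * (ρ x₁ * y₁ - ρ y₁ * x₁)  ≈⟨ diagonal≈0 ⟩
            0# ∎)))
          σα≈α : σ α ≈ α
          σα≈α = trans (σ.⟦⟧-cong α≈ρα) (σρ α)

        fixed-if-x₂≉0 : x₂ ≉0 → σ γ ≈ γ
        fixed-if-x₂≉0 x₂≉0 = ratio-fixed σβ≈β x≈ y≈ (trans y₁≈ (*-congʳ σβ≈β)) y₂≈
          where
          β = y₂ * x₂ ⁻¹
          y₂≈ : y₂ ≈ β * x₂
          y₂≈ = divide y₂ x₂≉0
          y₁≈ : y₁ ≈ σ β * x₁
          y₁≈ = *-cancelˡ (hom-≉0 σ-hom x₂≉0) (begin
            σ x₂ * y₁         ≈⟨ x-y≈0⇒x≈y _ _ cross≈0 ⟩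
            σ y₂ * x₁         ≈⟨ *-congʳ (trans (σ.⟦⟧-cong y₂≈) (σ.*-homo β x₂)) ⟩
            σ β * σ x₂ * x₁
              ≈⟨ solve 3 (λ b s x → b :* s :* x := s :* (b :* x)) refl (σ β) (σ x₂) x₁ ⟩
            σ x₂ * (σ β * x₁) ∎)
          ρy₁≈ : ρ y₁ ≈ β * ρ x₁
          ρy₁≈ = trans (ρ.⟦⟧-cong y₁≈) (trans (ρ.*-homo _ _) (*-congʳ (ρσ β)))
          σβ≈β : σ β ≈ β
          σβ≈β = sym (*-cancelˡ (norms-differ cx₁ cx₂ x₂≉0) (x-y≈0⇒x≈y _ _ (begin
            (k * (σ x₂ * x₂) + g₋₂ * (ρ x₁ * x₁)) * β - (k * (σ x₂ * x₂) + g₋₂ * (ρ x₁ * x₁)) * σ β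
              ≈⟨ solve 8 (λ k s x₂ g r x₁ b b′ →
                   (k :* (s :* x₂) :+ g :* (r :* x₁)) :* b :- (k :* (s :* x₂) :+ g :* (r :* x₁)) :* b′
                   := k :* (s :* (b :* x₂) :- b′ :* s :* x₂) :- g :* (r :* (b′ :* x₁) :- b :* r :* x₁))
                   refl k (σ x₂) x₂ g₋₂ (ρ x₁) x₁ β (σ β) ⟩
            k * (σ x₂ * (β * x₂) - σ β * σ x₂ * x₂) - g₋₂ * (ρ x₁ * (σ β * x₁) - β * ρ x₁ * x₁)
              ≈⟨ +-cong
                   (*-congˡ (+-cong (*-congˡ y₂≈)
                     (-‿cong (*-congʳ (trans (σ.⟦⟧-cong y₂≈) (σ.*-homo β x₂))))))
                   (-‿cong (*-congˡ (+-cong (*-congˡ y₁≈) (-‿cong (*-congʳ ρy₁≈))))) ⟨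
            k * (σ x₂ * y₂ - σ y₂ * x₂) - g₋₂ * (ρ x₁ * y₁ - ρ y₁ * x₁)  ≈⟨ diagonal≈0 ⟩
            0# ∎)))

      eigenvalue-fixed : σ γ ≈ γ
      eigenvalue-fixed = combine (decompose x) (decompose (γ * x))
        where
        combine : (∃₂ λ x₁ x₂ → x ≈ x₁ + x₂ × Component₁ x₁ × Component₂ x₂) →
                  (∃₂ λ y₁ y₂ → γ * x ≈ y₁ + y₂ × Component₁ y₁ × Component₂ y₂) → σ γ ≈ γ
        combine (x₁ , x₂ , x≈ , cx₁ , cx₂) (y₁ , y₂ , y≈ , cy₁ , cy₂) = by-cases (x₂ ≟ 0#)
          where
          sum≈0 = components-annihilate x≈ y≈ cx₁ cx₂ cy₁ cy₂
          by-cases : Dec (x₂ ≈ 0#) → σ γ ≈ γ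
          by-cases (yes x₂≈0) = fixed-if-x₂≈0 x≈ y≈ cx₁ cx₂
            (cross≈0 cx₁ cx₂ cy₁ cy₂ sum≈0) (diagonal≈0 cx₁ cx₂ cy₁ cy₂ sum≈0) x₂≈0
          by-cases (no x₂≉0) = fixed-if-x₂≉0 x≈ y≈ cx₁ cx₂
            (cross≈0 cx₁ cx₂ cy₁ cy₂ sum≈0) (diagonal≈0 cx₁ cx₂ cy₁ cy₂ sum≈0) x₂≉0

-- The theorem for x ↦ x^q

odd-^ : ∀ {q} → Odd q → ∀ n → Odd (q ℕ.^ n)
odd-^ odd zero = ≡.refl
odd-^ {q} odd (suc n) = ≡.trans (%-distribˡ-* q (q ℕ.^ n) 2)
  (≡.cong₂ (λ a b → (a ℕ.* b) ℕ.% 2) odd (odd-^ odd n))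

module Main {c ℓ : Level} (F : Field c ℓ) {p k q t : ℕ}
  (prime-p : Prime p) (q≡p^k : q ≡ p ℕ.^ k) (odd : Odd q) (1≤t : 1 ≤ t)
  (card : HasCardinality F (q ℕ.^ (2 ℕ.* t)))
  where

  open Field F hiding (zero)
  open FieldProperties F
  open FiniteField F card
  open RingMorphisms rawRing rawRing
  open IntegerSolver commutativeRing
  open import Algebra.Properties.Ring ring using (x+x≈x⇒x≈0; -‿involutive)
  open import Algebra.Properties.AbelianGroup +-abelianGroup
    using (inverseˡ-unique) renaming (x∙y⁻¹≈ε⇒x≈y to x-y≈0⇒x≈y; x≈y⇒x∙y⁻¹≈ε to x≈y⇒x-y≈0)
  open import Algebra.Properties.CommutativeSemiring.Exp commutativeSemiring
    using (^-congˡ; ^-congʳ; ^-assocʳ; ^-distrib-*)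
  open import Relation.Binary.Reasoning.Setoid setoid

  private
    :1 : ∀ {n} → Polynomial n
    :1 = con (+ 1)

  q^≡p^ : ∀ n → q ℕ.^ n ≡ p ℕ.^ (k ℕ.* n)
  q^≡p^ n = ≡.trans (≡.cong (ℕ._^ n) q≡p^k) (ℕ.^-*-assoc p k n)

  2≉0 : (1# + 1#) ≉0
  2≉0 = odd⇒1+1≉0 (odd-^ odd (2 ℕ.* t))

  -- Iterates of the q-power map are represented by a single power, so that every term of `ψ` is a
  -- value of `φ` up to rewriting the exponent.
  φ : ℕ → Carrier → Carrier
  φ n x = x ^ (q ℕ.^ n)

  φ-cong : ∀ n {x y} → x ≈ y → φ n x ≈ φ n y
  φ-cong n = ^-congˡ (q ℕ.^ n)

  -- As `q` is a power of `p`, this map is an iterate of the p-power map.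
  φ-+ : ∀ n x y → φ n (x + y) ≈ φ n x + φ n y
  φ-+ n x y rewrite q^≡p^ n = frobenius-^ {m = k ℕ.* (2 ℕ.* t)} prime-p (q^≡p^ (2 ℕ.* t)) (k ℕ.* n) x y

  φ-* : ∀ n x y → φ n (x * y) ≈ φ n x * φ n y
  φ-* n x y = ^-distrib-* x y (q ℕ.^ n)

  1^ : ∀ n → 1# ^ n ≈ 1#
  1^ zero    = refl
  1^ (suc n) = trans (*-identityˡ _) (1^ n)

  φ-0# : ∀ n → φ n 0# ≈ 0#
  φ-0# n = x+x≈x⇒x≈0 _ (trans (sym (φ-+ n 0# 0#)) (φ-cong n (+-identityˡ 0#)))

  φ-neg : ∀ n x → φ n (- x) ≈ - φ n x
  φ-neg n x = inverseˡ-unique _ _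
    (trans (sym (φ-+ n (- x) x)) (trans (φ-cong n (-‿inverseˡ x)) (φ-0# n)))

  φ-hom : ∀ n → IsRingHomomorphism (φ n)
  φ-hom n = record
    { isSemiringHomomorphism = record
      { isNearSemiringHomomorphism = record
        { +-isMonoidHomomorphism = record
          { isMagmaHomomorphism = record
            { isRelHomomorphism = record { cong = φ-cong n }
            ; homo              = φ-+ n
            }
          ; ε-homo = φ-0# n
          }
        ; *-homo = φ-* n
        }
      ; 1#-homo = 1^ (q ℕ.^ n)
      }
    ; -‿homo = φ-neg n
    }

  φ-φ : ∀ m n {l} → m ℕ.+ n ≡ l → ∀ x → φ m (φ n x) ≈ φ l x
  φ-φ m n ≡.refl x = begin
    (x ^ (q ℕ.^ n)) ^ (q ℕ.^ m)   ≈⟨ ^-assocʳ x (q ℕ.^ n) (q ℕ.^ m) ⟩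
    x ^ (q ℕ.^ n ℕ.* q ℕ.^ m)
      ≈⟨ ^-congʳ x (≡.trans (≡.cong (q ℕ.^_) (ℕ.+-comm m n)) (ℕ.^-distribˡ-+-* q n m)) ⟨
    x ^ (q ℕ.^ (m ℕ.+ n))         ∎

  φ-comm : ∀ m n x → φ m (φ n x) ≈ φ n (φ m x)
  φ-comm m n x = trans (φ-φ m n ≡.refl x) (sym (φ-φ n m (ℕ.+-comm n m) x))

  φ-period : ∀ x → φ (2 ℕ.* t) x ≈ x
  φ-period = x^N≈x

  φ-0 : ∀ x → φ 0 x ≈ x
  φ-0 x = *-identityʳ x

  -- The inverse of `σ` is realised as its power 2t - 1, which is literally the exponent in the last
  -- term of `ψ`.
  σ τ ρ : Carrier → Carrier
  σ = φ 1
  τ = φ t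
  ρ = φ (2 ℕ.* t ∸ 1)

  1+[2t-1]≡2t : 1 ℕ.+ (2 ℕ.* t ∸ 1) ≡ 2 ℕ.* t
  1+[2t-1]≡2t = ℕ.m+[n∸m]≡n (ℕ.≤-trans 1≤t (ℕ.m≤m+n t _))

  σρ : ∀ x → σ (ρ x) ≈ x
  σρ x = trans (φ-φ 1 (2 ℕ.* t ∸ 1) 1+[2t-1]≡2t x) (φ-period x)

  ρσ : ∀ x → ρ (σ x) ≈ x
  ρσ x = trans (φ-comm (2 ℕ.* t ∸ 1) 1 x) (σρ x)

  ττ : ∀ x → τ (τ x) ≈ x
  ττ x = trans (φ-φ t t (≡.cong (t ℕ.+_) (≡.sym (ℕ.+-identityʳ t))) x) (φ-period x)

  φ-suc : ∀ n x → φ (suc n) x ≈ σ (φ n x)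
  φ-suc n x = sym (φ-φ 1 n ≡.refl x)

  σ-fixed⇒φ-fixed : ∀ {x} → σ x ≈ x → ∀ n → φ n x ≈ x
  σ-fixed⇒φ-fixed {x} σx≈x zero    = φ-0 x
  σ-fixed⇒φ-fixed {x} σx≈x (suc n) =
    trans (φ-suc n x) (trans (φ-cong 1 (σ-fixed⇒φ-fixed σx≈x n)) σx≈x)

  σ-fixed⇒τ-fixed : ∀ {x} → σ x ≈ x → τ x ≈ x
  σ-fixed⇒τ-fixed σx≈x = σ-fixed⇒φ-fixed σx≈x t

  -1^φ : ∀ n → φ n (- 1#) ≈ - 1#
  -1^φ n = trans (φ-neg n 1#) (-‿cong (1^ (q ℕ.^ n)))

  -- In a field such an element is 1 or -1, and every `φ n` fixes both.
  square≈1⇒fixed : ∀ {x} → x * x ≈ 1# → ∀ n → φ n x ≈ x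
  square≈1⇒fixed {x} xx≈1 n with x ≟ 1#
  ... | yes x≈1 = trans (φ-cong n x≈1) (trans (1^ (q ℕ.^ n)) (sym x≈1))
  ... | no  x≉1 = trans (φ-cong n x≈-1) (trans (-1^φ n) (sym x≈-1))
    where
    x≈-1 : x ≈ - 1#
    x≈-1 = inverseˡ-unique x 1# (*-zero-right (x≉1 ∘ x-y≈0⇒x≈y x 1#) (begin
      (x - 1#) * (x + 1#)  ≈⟨ solve 1 (λ x → (x :- :1) :* (x :+ :1) := x :* x :- :1) refl x ⟩
      x * x - 1#           ≈⟨ x≈y⇒x-y≈0 xx≈1 ⟩
      0#                   ∎))

  x≈-x⇒x≈0 : ∀ {x} → x ≈ - x → x ≈ 0#
  x≈-x⇒x≈0 {x} x≈-x = *-zero-right 2≉0 (begin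
    (1# + 1#) * x  ≈⟨ solve 1 (λ x → (:1 :+ :1) :* x := x :- :- x) refl x ⟩
    x - - x        ≈⟨ x≈y⇒x-y≈0 x≈-x ⟩
    0#             ∎)

  1≉-1 : ¬ (1# ≈ - 1#)
  1≉-1 1≈-1 = 1≉0 (x≈-x⇒x≈0 1≈-1)

  -- v σ(v) = -1 makes v fixed by σ², so τ(v) is v or σ(v).
  no-skew-unit : ∀ {v} → v * σ v ≈ - 1# → ¬ (τ v ≈ - v)
  no-skew-unit {v} vσv≈-1 τv≈-v = case (orbit t)
    where
    v≉0 : v ≉0
    v≉0 v≈0 = 1≉0 (begin
      1#            ≈⟨ -‿involutive 1# ⟨
      - - 1#        ≈⟨ -‿cong vσv≈-1 ⟨
      - (v * σ v)   ≈⟨ -‿cong (*-congʳ v≈0) ⟩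
      - (0# * σ v)  ≈⟨ solve 1 (λ x → :- (con (+ 0) :* x) := con (+ 0)) refl (σ v) ⟩
      0#            ∎)

    σσv≈v : σ (σ v) ≈ v
    σσv≈v = *-cancelˡ (λ σv≈0 → v≉0 (begin
      v          ≈⟨ ρσ v ⟨
      ρ (σ v)    ≈⟨ φ-cong (2 ℕ.* t ∸ 1) σv≈0 ⟩
      ρ 0#       ≈⟨ φ-0# (2 ℕ.* t ∸ 1) ⟩
      0#         ∎)) (begin
      σ v * σ (σ v)   ≈⟨ φ-* 1 v (σ v) ⟨
      σ (v * σ v)     ≈⟨ φ-cong 1 vσv≈-1 ⟩
      σ (- 1#)        ≈⟨ -1^φ 1 ⟩
      - 1#            ≈⟨ vσv≈-1 ⟨
      v * σ v         ≈⟨ *-comm v (σ v) ⟩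
      σ v * v         ∎)

    orbit : ∀ n → (φ n v ≈ v) ⊎ (φ n v ≈ σ v)
    orbit zero = inj₁ (φ-0 v)
    orbit (suc n) with orbit n
    ... | inj₁ eq = inj₂ (trans (φ-suc n v) (φ-cong 1 eq))
    ... | inj₂ eq = inj₁ (trans (φ-suc n v) (trans (φ-cong 1 eq) σσv≈v))

    case : ¬ ((τ v ≈ v) ⊎ (τ v ≈ σ v))
    case (inj₁ τv≈v)  = v≉0 (x≈-x⇒x≈0 (trans (sym τv≈v) τv≈-v))
    -- Now σ(v) = -v turns v σ(v) = -1 into v² = 1, so `τ` fixes `v` after all and v = -v.
    case (inj₂ τv≈σv) = v≉0 (x≈-x⇒x≈0 (trans (sym (square≈1⇒fixed vv≈1 t)) τv≈-v))
      where
      vv≈1 : v * v ≈ 1#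
      vv≈1 = begin
        v * v         ≈⟨ solve 1 (λ v → v :* v := :- (v :* :- v)) refl v ⟩
        - (v * - v)   ≈⟨ -‿cong (*-congˡ (trans (sym τv≈-v) τv≈σv)) ⟩
        - (v * σ v)   ≈⟨ -‿cong vσv≈-1 ⟩
        - - 1#        ≈⟨ -‿involutive 1# ⟩
        1#            ∎

  module _ {h : Carrier} (h∉ : ¬ (τ h ≈ h)) (h*τh : h * τ h ≈ - 1#) where

    -- hσ²(h) = 1 makes h fixed by σ⁴, so τ(h) is one of h, σ(h), σ²(h), σ³(h).
    h*σσh≉1 : ¬ (h * σ (σ h) ≈ 1#)
    h*σσh≉1 hσσh≈1 = case (orbit t)
      where
      σ² : Carrier → Carrier
      σ² x = σ (σ x)

      σ²h≉0 : σ² h ≉0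
      σ²h≉0 eq = 1≉0 (trans (sym hσσh≈1) (trans (*-congˡ eq) (zeroʳ h)))

      σ⁴h≈h : σ² (σ² h) ≈ h
      σ⁴h≈h = *-cancelˡ σ²h≉0 (begin
        σ² h * σ² (σ² h)   ≈⟨ trans (φ-cong 1 (φ-* 1 _ _)) (φ-* 1 _ _) ⟨
        σ² (h * σ² h)      ≈⟨ φ-cong 1 (φ-cong 1 hσσh≈1) ⟩
        σ² 1#              ≈⟨ trans (φ-cong 1 (1^ (q ℕ.^ 1))) (1^ (q ℕ.^ 1)) ⟩
        1#                 ≈⟨ hσσh≈1 ⟨
        h * σ² h           ≈⟨ *-comm _ _ ⟩
        σ² h * h           ∎)

      orbit : ∀ n → ((φ n h ≈ h) ⊎ (φ n h ≈ σ h)) ⊎ ((φ n h ≈ σ² h) ⊎ (φ n h ≈ σ (σ² h)))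
      orbit zero = inj₁ (inj₁ (φ-0 h))
      orbit (suc n) with orbit n
      ... | inj₁ (inj₁ eq) = inj₁ (inj₂ (trans (φ-suc n h) (φ-cong 1 eq)))
      ... | inj₁ (inj₂ eq) = inj₂ (inj₁ (trans (φ-suc n h) (φ-cong 1 eq)))
      ... | inj₂ (inj₁ eq) = inj₂ (inj₂ (trans (φ-suc n h) (φ-cong 1 eq)))
      ... | inj₂ (inj₂ eq) = inj₁ (inj₁ (trans (φ-suc n h) (trans (φ-cong 1 eq) σ⁴h≈h)))

      -- Otherwise h² = 1, and `h` would be fixed by `τ`.
      σ²h≉h : ¬ (σ² h ≈ h)
      σ²h≉h eq = h∉ (square≈1⇒fixed (trans (*-congˡ (sym eq)) hσσh≈1) t)

      case : ¬ (((τ h ≈ h) ⊎ (τ h ≈ σ h)) ⊎ ((τ h ≈ σ² h) ⊎ (τ h ≈ σ (σ² h))))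
      case (inj₁ (inj₁ eq)) = h∉ eq
      -- Applying τ(h) = σ(h) twice gives σ²(h) = τ²(h) = h.
      case (inj₁ (inj₂ eq)) = σ²h≉h (begin
        σ (σ h)        ≈⟨ φ-cong 1 eq ⟨
        σ (τ h)        ≈⟨ φ-comm 1 t h ⟩
        τ (σ h)        ≈⟨ φ-cong t eq ⟨
        τ (τ h)        ≈⟨ ττ h ⟩
        h              ∎)
      case (inj₂ (inj₁ eq)) = 1≉-1 (trans (sym hσσh≈1) (trans (*-congˡ (sym eq)) h*τh))
      -- Here τ²(h) = σ⁶(h), so σ⁶(h) = h; with σ⁴(h) = h this leaves σ²(h) = h.
      case (inj₂ (inj₂ eq)) = σ²h≉h (begin
        σ² h                  ≈⟨ φ-cong 1 (φ-cong 1 σ⁴h≈h) ⟨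
        σ² (σ² (σ² h))        ≈⟨ φ-cong 1 (φ-cong 1 (φ-cong 1 eq)) ⟨
        σ² (σ (τ h))          ≈⟨ φ-cong 1 (φ-cong 1 (φ-comm 1 t h)) ⟩
        σ² (τ (σ h))          ≈⟨ φ-cong 1 (φ-comm 1 t (σ h)) ⟩
        σ (τ (σ² h))          ≈⟨ φ-comm 1 t (σ² h) ⟩
        τ (σ (σ² h))          ≈⟨ φ-cong t eq ⟨
        τ (τ h)               ≈⟨ ττ h ⟩
        h                     ∎)

    private
      module Criterion = SemilinearForms.ScatteredCriterion F _≟_ 2≉0
        (φ-hom 1) (φ-hom (2 ℕ.* t ∸ 1)) (φ-hom t) σρ ρσ ττ (φ-comm t 1) (φ-comm t (2 ℕ.* t ∸ 1))
        σ-fixed⇒τ-fixed no-skew-unit h h*τh h*σσh≉1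

    -- Three facts translate the coefficients: `τ` after `ρ` has exponent t - 1 modulo 2t;
    -- -1/φ(t+1)(h) is σ(h), by applying `σ` to h τ(h) = -1; and `ρ h` cancels the inverse in the
    -- last term.
    cleared≈ρh*ψ : ∀ x → Criterion.cleared x ≈ ρ h * ψ F q t h x
    cleared≈ρh*ψ x = sym (begin
      ρ h * (x ^ q + φ (t ∸ 1) x - h * φ (t ℕ.+ 1) h ⁻¹ * φ (t ℕ.+ 1) x + h * ρ h ⁻¹ * ρ x)
        ≈⟨ solve 8 (λ b s u h i v j w →
             b :* (s :+ u :- h :* i :* v :+ h :* j :* w)
             := b :* s :+ b :* u :+ b :* (h :* :- i) :* v :+ h :* (b :* j) :* w)
             refl (ρ h) (x ^ q) (φ (t ∸ 1) x) h (φ (t ℕ.+ 1) h ⁻¹) (φ (t ℕ.+ 1) x) (ρ h ⁻¹) (ρ x) ⟩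
      ρ h * x ^ q + ρ h * φ (t ∸ 1) x + ρ h * (h * - φ (t ℕ.+ 1) h ⁻¹) * φ (t ℕ.+ 1) x
        + h * (ρ h * ρ h ⁻¹) * ρ x
        -- The exponent in `σ` is `q ℕ.^ 1`, which unfolds to `q ℕ.* 1` and not to `q`.
        ≈⟨ +-cong (+-cong (+-cong (*-congˡ (^-congʳ x (≡.sym (ℕ.*-identityʳ q))))
             (*-congˡ (sym τρx))) (*-cong (*-congˡ (*-congˡ inverse-τσh)) (sym (φ-φ t 1 ≡.refl x))))
             (*-congʳ (trans (*-congˡ (inverse (ρ h) ρh≉0)) (*-identityʳ h))) ⟩
      Criterion.cleared x ∎)
      where
      ρh≉0 : ρ h ≉0
      ρh≉0 = Criterion.h₋₁≉0

      τρx : τ (ρ x) ≈ φ (t ∸ 1) x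
      τρx = begin
        τ (ρ x)                        ≈⟨ φ-φ t (2 ℕ.* t ∸ 1) exponent x ⟩
        φ (2 ℕ.* t ℕ.+ (t ∸ 1)) x      ≈⟨ φ-φ (2 ℕ.* t) (t ∸ 1) ≡.refl x ⟨
        φ (2 ℕ.* t) (φ (t ∸ 1) x)      ≈⟨ φ-period _ ⟩
        φ (t ∸ 1) x                    ∎
        where
        exponent : t ℕ.+ (2 ℕ.* t ∸ 1) ≡ 2 ℕ.* t ℕ.+ (t ∸ 1)
        exponent = ≡.trans (≡.sym (ℕ.+-∸-assoc t (ℕ.≤-trans 1≤t (ℕ.m≤m+n t _))))
          (≡.trans (≡.cong (_∸ 1) (ℕ.+-comm t (2 ℕ.* t))) (ℕ.+-∸-assoc (2 ℕ.* t) 1≤t))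

      inverse-τσh : - φ (t ℕ.+ 1) h ⁻¹ ≈ σ h
      inverse-τσh = *-cancelˡ w≉0 (begin
        w * - w ⁻¹       ≈⟨ solve 2 (λ w i → w :* :- i := :- (w :* i)) refl w (w ⁻¹) ⟩
        - (w * w ⁻¹)     ≈⟨ -‿cong (inverse w w≉0) ⟩
        - 1#             ≈⟨ -1^φ 1 ⟨
        σ (- 1#)         ≈⟨ φ-cong 1 h*τh ⟨
        σ (h * τ h)      ≈⟨ φ-* 1 h (τ h) ⟩
        σ h * σ (τ h)    ≈⟨ *-congˡ (φ-φ 1 t (ℕ.+-comm 1 t) h) ⟩
        σ h * w          ≈⟨ *-comm (σ h) w ⟩
        w * σ h          ∎)
        where
        w = φ (t ℕ.+ 1) h
        w≉0 : w ≉0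
        w≉0 = SemilinearForms.hom-≉0 F (φ-hom (t ℕ.+ 1)) Criterion.h₀≉0

    ψ-scattered : Scattered F q (ψ F q t h)
    -- The goal `InSubfield F q 1 γ` unfolds to `σ γ ≈ γ`.
    ψ-scattered x γ x≉0 eigen = Criterion.eigenvalue-fixed x≉0 (begin
      Criterion.cleared (γ * x)      ≈⟨ cleared≈ρh*ψ (γ * x) ⟩
      ρ h * ψ F q t h (γ * x)        ≈⟨ *-congˡ eigen ⟩
      ρ h * (γ * ψ F q t h x)
        ≈⟨ solve 3 (λ b γ f → b :* (γ :* f) := γ :* (b :* f)) refl (ρ h) γ (ψ F q t h x) ⟩
      γ * (ρ h * ψ F q t h x)        ≈⟨ *-congˡ (cleared≈ρh*ψ x) ⟨
      γ * Criterion.cleared x        ∎)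

open import Data.Nat using (ℕ; _≤_; _*_)

theorem3p1 : ∀ {c ℓ} (F : Field c ℓ) (q t : ℕ) → IsPrimePower q → Odd q → 3 ≤ t
    → HasCardinality F (q Data.Nat.^ (2 * t))
    → (h : Field.Carrier F) → ¬ InSubfield F q t h
    → Field._≈_ F (Field._^_ F h (q Data.Nat.^ t Data.Nat.+ 1)) (Field.-_ F (Field.1# F))
    → Scattered F q (ψ F q t h)
theorem3p1 F q t (p , k , prime-p , _ , q≡p^k) odd 3≤t card h h∉ h^[q^t+1]≈-1 =
  Main.ψ-scattered F {k = k} prime-p q≡p^k odd (ℕ.≤-trans (s≤s z≤n) 3≤t) card h∉
    -- The hypothesis on the power q^t + 1 is split as τ(h) times `h ^ 1`, where `h ^ 1` unfolds to
    -- `h * 1#`.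
    (trans (*-comm _ _) (trans (*-congˡ (sym (*-identityʳ h)))
      (trans (sym (^-homo-* h (q ℕ.^ t) 1)) h^[q^t+1]≈-1)))
  where
  open Field F
  open import Algebra.Properties.CommutativeSemiring.Exp commutativeSemiring using (^-homo-*)
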